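{- Let $m,n,t>0$ be integers with $t\le n$. (i) For all integers $0\le b\le a\le n-t$, the number of $(m,t)$-Dyck paths of height $n$ with exactly $a$ valleys and exactly $b$ returns is $$\binom{n-t}{a}\binom{mn-b-1}{a-b}-m\binom{n-t+1}{a+1}\binom{mn-b-2}{a-b-1}.$$ (ii) For all integers $0\le b\le a\le n-t$, the number of $(m,t)$-Dyck paths of height $n$ with exactly $a$ $m$-valleys and exactly $b$ returns is $$\binom{n-b-2}{a-b}\binom{mn-t+1}{n-t-a}-m\binom{n-b-1}{a-b}\binom{mn-t}{n-t-a-1}.$$ (iii) For every $i\in\{1,\ldots,m-1\}$ and all integers $a,b\ge 0$ with $a+b\le n-t$, the number of $(m,t)$-Dyck paths of height $n$ with exactly $a$ $i$-valleys and exactly $b$ returns is $$\frac{t+b}{n}\binom{n}{a}\binom{mn-t-b-1}{n-t-a-b}.$$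
   Context: An $(m,t)$-Dyck path of height $n$ is a lattice path from $(0,0)$ to $(mn,n)$ using only north steps $N=(0,1)$ and east steps $E=(1,0)$, which starts with at least $t$ north steps and stays weakly above the line $x=my$ (i.e. every lattice point $(p,q)$ on it satisfies $p\le mq$). A valley of such a path is a lattice point on the path that is preceded by an east step and followed by a north step. For $i\in\{1,\ldots,m\}$, an $i$-valley is a valley whose $x$-coordinate is congruent to $i$ modulo $m$ (so an $m$-valley has $x$-coordinate divisible by $m$). A return is a valley of the form $(mi,i)$ for some $i\in\{1,\ldots,n-1\}$. Binomial convention: $\binom{z}{k}=z(z-1)\cdots(z-k+1)/k!$ for integers $k\ge 0$ and arbitrary integers $z$, and $\binom{z}{k}=0$ for $k<0$. -}

module Defs where

open import Data.Integer as ℤ using (ℤ; +_; -[1+_]; 1ℤ)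
open import Data.List using (List; []; _∷_; foldl; filter; length; replicate)
open import Data.List.Membership.Propositional using (_∈_)
open import Data.List.Relation.Binary.Prefix.Heterogeneous using (Prefix)
open import Data.List.Relation.Unary.All using (All)
open import Data.List.Relation.Unary.Unique.Propositional using (Unique)
open import Data.List.Scans.Base using (scanl)
open import Data.Nat using (ℕ; zero; suc; _*_; _≤_; _<_; _≤?_; _<?_; _≟_; _%_; _!; NonZero)
open import Data.Nat.Properties using (_!≢0)
open import Data.Product using (_×_; _,_; ∃-syntax)
open import Data.Rational using (ℚ; 0ℚ; _/_)
open import Function.Bundles using (_⇔_)
open import Relation.Binary.PropositionalEquality using (_≡_; refl)
open import Relation.Nullary.Decidable using (map′; _×-dec_)
open import Relation.Unary using (Decidable)

data Step : Set where
  N E : Step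

Point : Set
Point = ℕ × ℕ

step : Point → Step → Point
step (x , y) N = x , suc y
step (x , y) E = suc x , y

origin : Point
origin = 0 , 0

endpoint : List Step → Point
endpoint = foldl step origin

-- All lattice points visited, including both endpoints.
points : List Step → List Point
points = scanl step origin

record IsDyckPath (m t n : ℕ) (w : List Step) : Set where
  field
    ends   : endpoint w ≡ (m * n , n)
    starts : Prefix _≡_ (replicate t N) w
    above  : All (λ { (p , q) → p ≤ m * q }) (points w)

valleysFrom : Point → List Step → List Point
valleysFrom v []          = []
valleysFrom v (E ∷ N ∷ w) = step v E ∷ valleysFrom (step v E) (N ∷ w)
valleysFrom v (s ∷ w)     = valleysFrom (step v s) w

valleys : List Step → List Point
valleys = valleysFrom origin

IsResidue : (m : ℕ) .{{_ : NonZero m}} → ℕ → Point → Set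
IsResidue m i (x , y) = x % m ≡ i % m

isResidue? : (m : ℕ) .{{_ : NonZero m}} (i : ℕ) → Decidable (IsResidue m i)
isResidue? m i (x , y) = x % m ≟ i % m

IsReturn : (m n : ℕ) → Point → Set
IsReturn m n v = ∃[ i ] (1 ≤ i × i < n × v ≡ (m * i , i))

isReturn? : (m n : ℕ) → Decidable (IsReturn m n)
isReturn? m n (x , y) =
  map′ (λ { (1≤y , y<n , refl) → y , 1≤y , y<n , refl })
       (λ { (_ , 1≤y , y<n , refl) → 1≤y , y<n , refl })
       (1 ≤? y ×-dec y <? n ×-dec x ≟ m * y)

#valleys : List Step → ℕ
#valleys w = length (valleys w)

#valleys[_mod_] : ℕ → (m : ℕ) .{{_ : NonZero m}} → List Step → ℕ
#valleys[ i mod m ] w = length (filter (isResidue? m i) (valleys w))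

#returns : (m n : ℕ) → List Step → ℕ
#returns m n w = length (filter (isReturn? m n) (valleys w))

-- Exactly k elements satisfy P: they can be listed without repetition
-- in a list of length k.
_HasCardinality_ : {A : Set} → (A → Set) → ℕ → Set
P HasCardinality k =
  ∃[ xs ] (Unique xs × (∀ x → x ∈ xs ⇔ P x) × length xs ≡ k)

-- z (z - 1) ⋯ (z - k + 1)
falling : ℤ → ℕ → ℤ
falling z zero    = 1ℤ
falling z (suc k) = falling z k ℤ.* (z ℤ.- + k)

binom : ℤ → ℤ → ℚ
binom z (+ k)    = (falling z k / k !) {{k !≢0}}
binom z -[1+ _ ] = 0ℚ

{-# OPTIONS --safe #-}
-- Read a path from its start and let e and r be the numbers of east and north steps still to come,
-- so that the point reached lies on or above the line x = m y iff m r ≤ e.  The completions of a path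
-- with prescribed statistics then satisfy a recurrence in (e , r), according to the next step, in which
-- one must remember whether the last step was E (so that N creates a valley).  On the line itself (e = m r)
-- the next step is N, and it creates a return.  In every case the solution has the shape
-- p C(z,k) − m q C(z−1,k−1), with p and q binomial coefficients.  Extended to integer arguments such
-- expressions satisfy the recurrence by Pascal's rule, while the absorption identity k C(z,k) = z C(z−1,k−1)
-- makes them vanish on the line when no return is allowed.
module Submission where

open import Defs
open import Data.Bool using (true; false)
open import Data.Empty using (⊥-elim)
open import Data.Integer as ℤ using (ℤ; +_; -[1+_])
import Data.Integer.Properties as ℤ
import Data.Integer.Tactic.RingSolver as ℤ-Solver
open import Data.List using (List; []; _∷_; _++_; foldl; filter; length; map; replicate)
open import Data.List.Membership.Propositional using (_∈_)
open import Data.List.Membership.Propositional.Properties using (∈-map⁺; ∈-map⁻; ∈-++⁺ˡ; ∈-++⁺ʳ; ∈-++⁻)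
import Data.List.Properties as List
open import Data.List.Relation.Binary.Prefix.Heterogeneous using (Prefix; []; _∷_)
open import Data.List.Relation.Unary.All as All using (All; []; _∷_)
open import Data.List.Relation.Unary.AllPairs using ([]; _∷_)
open import Data.List.Relation.Unary.Any using (here)
open import Data.List.Relation.Unary.Unique.Propositional using (Unique)
import Data.List.Relation.Unary.Unique.Propositional.Properties as Unique
open import Data.List.Scans.Base using (scanl)
open import Data.Maybe using (just; nothing)
open import Data.Nat as ℕ using (ℕ; zero; suc; pred; _≤_; _<_; _∸_; _!; z≤n; s≤s; NonZero)
open import Data.Nat.Divisibility using (_∣_; divides; ∣m+n∣m⇒∣n; m∣m*n; n∣m*n; >⇒∤)
open import Data.Nat.DivMod using (m≡m%n+[m/n]*n; m%n<n; m%n%n≡m%n; m<n⇒m%n≡m; m<n⇒m/n≡0; n%n≡0; m*n/n≡m; /-congˡ; %-remove-+ˡ; %-remove-+ʳ; +-distrib-/-∣ˡ; +-distrib-/-∣ʳ)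
import Data.Nat.Properties as ℕ
open import Data.Product using (_×_; _,_; proj₁; proj₂; ∃-syntax)
open import Data.Product.Properties using (,-injectiveˡ; ,-injectiveʳ)
open import Data.Rational using (ℚ; 0ℚ; 1ℚ; _+_; _*_; _-_; _/_; toℚᵘ; fromℚᵘ)
import Data.Rational.Properties as ℚ
open import Data.Rational.Unnormalised as ℚᵘ using (mkℚᵘ; *≡*)
import Data.Rational.Unnormalised.Properties as ℚᵘ
open import Data.Sum using (_⊎_; inj₁; inj₂)
open import Data.Unit using (tt)
open import Function using (_∘_; id)
open import Function.Bundles using (_⇔_; mk⇔; Equivalence)
open import Level using (0ℓ)
open import Relation.Binary.PropositionalEquality using (_≡_; _≢_; refl; sym; trans; cong; cong₂; subst; module ≡-Reasoning)
open import Relation.Nullary using (¬_; yes; no; does; contradiction)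
open import Relation.Unary using (Decidable)
open import Relation.Unary.Properties using (U?)
open import Tactic.RingSolver using (solve-∀)
import Tactic.RingSolver.Core.AlmostCommutativeRing as ACR

open Equivalence using (to; from)

-- Rational arithmetic and the embedding of the integers.

ℚ-ring : ACR.AlmostCommutativeRing 0ℓ 0ℓ
ℚ-ring = ACR.fromCommutativeRing ℚ.+-*-commutativeRing isZero
  where
  isZero : ∀ x → _
  isZero x with 0ℚ ℚ.≟ x
  ... | yes p = just p
  ... | no  _ = nothing

ι : ℤ → ℚ
ι z = z / 1

fromℚᵘ-* : ∀ p q → fromℚᵘ p * fromℚᵘ q ≡ fromℚᵘ (p ℚᵘ.* q)
fromℚᵘ-* p q = ℚ.toℚᵘ-injective (begin
  toℚᵘ (fromℚᵘ p * fromℚᵘ q)             ≈⟨ ℚ.toℚᵘ-homo-* (fromℚᵘ p) (fromℚᵘ q) ⟩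
  toℚᵘ (fromℚᵘ p) ℚᵘ.* toℚᵘ (fromℚᵘ q)   ≈⟨ ℚᵘ.*-cong (ℚ.toℚᵘ-fromℚᵘ p) (ℚ.toℚᵘ-fromℚᵘ q) ⟩
  p ℚᵘ.* q                               ≈⟨ ℚ.toℚᵘ-fromℚᵘ (p ℚᵘ.* q) ⟨
  toℚᵘ (fromℚᵘ (p ℚᵘ.* q))               ∎)
  where open ℚᵘ.≃-Reasoning

fromℚᵘ-+ : ∀ p q → fromℚᵘ p + fromℚᵘ q ≡ fromℚᵘ (p ℚᵘ.+ q)
fromℚᵘ-+ p q = ℚ.toℚᵘ-injective (begin
  toℚᵘ (fromℚᵘ p + fromℚᵘ q)             ≈⟨ ℚ.toℚᵘ-homo-+ (fromℚᵘ p) (fromℚᵘ q) ⟩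
  toℚᵘ (fromℚᵘ p) ℚᵘ.+ toℚᵘ (fromℚᵘ q)   ≈⟨ ℚᵘ.+-cong (ℚ.toℚᵘ-fromℚᵘ p) (ℚ.toℚᵘ-fromℚᵘ q) ⟩
  p ℚᵘ.+ q                               ≈⟨ ℚ.toℚᵘ-fromℚᵘ (p ℚᵘ.+ q) ⟨
  toℚᵘ (fromℚᵘ (p ℚᵘ.+ q))               ∎)
  where open ℚᵘ.≃-Reasoning

ι-* : ∀ x y → ι (x ℤ.* y) ≡ ι x * ι y
ι-* x y = sym (fromℚᵘ-* (mkℚᵘ x 0) (mkℚᵘ y 0))

ι-+ : ∀ x y → ι (x ℤ.+ y) ≡ ι x + ι y
ι-+ x y = sym (trans (fromℚᵘ-+ (mkℚᵘ x 0) (mkℚᵘ y 0))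
  (cong₂ (λ u v → ι (u ℤ.+ v)) (ℤ.*-identityʳ x) (ℤ.*-identityʳ y)))

ι-- : ∀ x y → ι (x ℤ.- y) ≡ ι x - ι y
ι-- x y = begin
  ι (x ℤ.- y)                   ≡⟨ lemma (ι (x ℤ.- y)) (ι y) ⟩
  ι (x ℤ.- y) + ι y - ι y       ≡⟨ cong (_- ι y) (ι-+ (x ℤ.- y) y) ⟨
  ι (x ℤ.- y ℤ.+ y) - ι y       ≡⟨ cong (λ u → ι u - ι y) (lemma′ x y) ⟩
  ι x - ι y                     ∎
  where
  open ≡-Reasoning
  lemma : ∀ u v → u ≡ u + v - v
  lemma = solve-∀ ℚ-ring
  lemma′ : ∀ u v → u ℤ.- v ℤ.+ v ≡ u
  lemma′ = ℤ-Solver.solve-∀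

/-*-cancel : ∀ x q .{{_ : NonZero q}} → x / q * ι (+ q) ≡ ι x
/-*-cancel x (suc q) = trans (fromℚᵘ-* (mkℚᵘ x q) (mkℚᵘ (+ suc q) 0))
  (ℚ.fromℚᵘ-cong {mkℚᵘ x q ℚᵘ.* mkℚᵘ (+ suc q) 0} {mkℚᵘ x 0}
    (*≡* (ℤ.*-assoc x (+ suc q) (+ 1))))

-- The means of removing denominators: the identities below that involve a factorial, a height or a
-- division are checked after multiplication by it.
ι-*-cancelʳ : ∀ q .{{_ : NonZero q}} {x y} → x * ι (+ q) ≡ y * ι (+ q) → x ≡ y
ι-*-cancelʳ q {x} {y} eq = begin
  x                              ≡⟨ unit x ⟨
  x * ι (+ q) * (+ 1 / q)        ≡⟨ cong (_* (+ 1 / q)) eq ⟩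
  y * ι (+ q) * (+ 1 / q)        ≡⟨ unit y ⟩
  y                              ∎
  where
  open ≡-Reasoning
  swap : ∀ a b c → a * b * c ≡ a * (c * b)
  swap = solve-∀ ℚ-ring
  unit : ∀ z → z * ι (+ q) * (+ 1 / q) ≡ z
  unit z = trans (swap z (ι (+ q)) (+ 1 / q))
           (trans (cong (z *_) (/-*-cancel (+ 1) q)) (ℚ.*-identityʳ z))

-- Binomial coefficients with integer arguments: absorption and Pascal's rule.

falling-shift : ∀ z k → falling z (suc k) ≡ z ℤ.* falling (z ℤ.- + 1) k
falling-shift z zero    = lemma z
  where
  lemma : ∀ z → + 1 ℤ.* (z ℤ.- + 0) ≡ z ℤ.* + 1
  lemma = ℤ-Solver.solve-∀
falling-shift z (suc k) = begin
  falling z (suc k) ℤ.* (z ℤ.- + suc k)                     ≡⟨ cong (ℤ._* (z ℤ.- + suc k)) (falling-shift z k) ⟩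
  z ℤ.* falling (z ℤ.- + 1) k ℤ.* (z ℤ.- (+ 1 ℤ.+ + k))     ≡⟨ lemma z (falling (z ℤ.- + 1) k) (+ k) ⟩
  z ℤ.* (falling (z ℤ.- + 1) k ℤ.* (z ℤ.- + 1 ℤ.- + k))     ∎
  where
  open ≡-Reasoning
  lemma : ∀ z f k → z ℤ.* f ℤ.* (z ℤ.- (+ 1 ℤ.+ k)) ≡ z ℤ.* (f ℤ.* (z ℤ.- + 1 ℤ.- k))
  lemma = ℤ-Solver.solve-∀

binom-! : ∀ z k → binom z (+ k) * ι (+ (k !)) ≡ ι (falling z k)
binom-! z k = /-*-cancel (falling z k) (k !) {{k ℕ.!≢0}}

ι-suc-! : ∀ k → ι (+ (suc k !)) ≡ ι (+ suc k) * ι (+ (k !))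
ι-suc-! k = trans (cong ι (ℤ.pos-* (suc k) (k !))) (ι-* (+ suc k) (+ (k !)))

-- For positive lower index `suc k`, multiplying by `k !` reduces it to `falling-shift`. For lower
-- index zero or less both sides vanish by the convention for negative lower indices.
binom-absorb : ∀ z k → ι k * binom z k ≡ ι z * binom (z ℤ.- + 1) (k ℤ.- + 1)
binom-absorb z (+ zero)  = trans (ℚ.*-zeroˡ (binom z (+ 0))) (sym (ℚ.*-zeroʳ (ι z)))
binom-absorb z (+ suc k) = ι-*-cancelʳ (k !) {{k ℕ.!≢0}} (begin
  ι (+ suc k) * binom z (+ suc k) * ι (+ (k !))     ≡⟨ lemma (ι (+ suc k)) (binom z (+ suc k)) (ι (+ (k !))) ⟩
  binom z (+ suc k) * (ι (+ suc k) * ι (+ (k !)))   ≡⟨ cong (binom z (+ suc k) *_) (ι-suc-! k) ⟨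
  binom z (+ suc k) * ι (+ (suc k !))               ≡⟨ binom-! z (suc k) ⟩
  ι (falling z (suc k))                             ≡⟨ cong ι (falling-shift z k) ⟩
  ι (z ℤ.* falling (z ℤ.- + 1) k)                   ≡⟨ ι-* z (falling (z ℤ.- + 1) k) ⟩
  ι z * ι (falling (z ℤ.- + 1) k)                   ≡⟨ cong (ι z *_) (binom-! (z ℤ.- + 1) k) ⟨
  ι z * (binom (z ℤ.- + 1) (+ k) * ι (+ (k !)))     ≡⟨ ℚ.*-assoc (ι z) (binom (z ℤ.- + 1) (+ k)) (ι (+ (k !))) ⟨
  ι z * binom (z ℤ.- + 1) (+ k) * ι (+ (k !))       ∎)
  where
  open ≡-Reasoning
  lemma : ∀ a b c → a * b * c ≡ b * (a * c)
  lemma = solve-∀ ℚ-ring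
binom-absorb z -[1+ k ]  = trans (ℚ.*-zeroʳ (ι -[1+ k ])) (sym (ℚ.*-zeroʳ (ι z)))

-- After clearing the factorial, split the factor z of z (z-1) ⋯ (z-k) as (z-1-k) + (k+1). No sign
-- condition is imposed on `z` or `k`, so the recurrences below can be checked without boundary
-- cases.
binom-pascal : ∀ z k → binom z k ≡ binom (z ℤ.- + 1) k + binom (z ℤ.- + 1) (k ℤ.- + 1)
binom-pascal z (+ zero)  = refl
binom-pascal z (+ suc k) = ι-*-cancelʳ (suc k !) {{suc k ℕ.!≢0}} (begin
  binom z (+ suc k) * ι (+ (suc k !))                                  ≡⟨ binom-! z (suc k) ⟩
  ι (falling z (suc k))                                                ≡⟨ cong ι falling-pascal ⟩
  ι (falling y (suc k) ℤ.+ + suc k ℤ.* falling y k)                    ≡⟨ ι-+ (falling y (suc k)) (+ suc k ℤ.* falling y k) ⟩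
  ι (falling y (suc k)) + ι (+ suc k ℤ.* falling y k)                  ≡⟨ cong₂ _+_ (sym (binom-! y (suc k)))
    (trans (ι-* (+ suc k) (falling y k)) (cong (ι (+ suc k) *_) (sym (binom-! y k)))) ⟩
  binom y (+ suc k) * ι (+ (suc k !)) + ι (+ suc k) * (binom y (+ k) * ι (+ (k !)))
    ≡⟨ cong (λ u → binom y (+ suc k) * ι (+ (suc k !)) + u)
         (trans (lemma₁ (ι (+ suc k)) (binom y (+ k)) (ι (+ (k !)))) (cong (binom y (+ k) *_) (sym (ι-suc-! k)))) ⟩
  binom y (+ suc k) * ι (+ (suc k !)) + binom y (+ k) * ι (+ (suc k !))
    ≡⟨ ℚ.*-distribʳ-+ (ι (+ (suc k !))) (binom y (+ suc k)) (binom y (+ k)) ⟨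
  (binom y (+ suc k) + binom y (+ k)) * ι (+ (suc k !))                ∎)
  where
  open ≡-Reasoning
  y = z ℤ.- + 1
  lemma₁ : ∀ a b c → a * (b * c) ≡ b * (a * c)
  lemma₁ = solve-∀ ℚ-ring
  lemma₂ : ∀ z f k → z ℤ.* f ≡ f ℤ.* (z ℤ.- + 1 ℤ.- k) ℤ.+ (+ 1 ℤ.+ k) ℤ.* f
  lemma₂ = ℤ-Solver.solve-∀
  falling-pascal : falling z (suc k) ≡ falling y (suc k) ℤ.+ + suc k ℤ.* falling y k
  falling-pascal = trans (falling-shift z k) (lemma₂ z (falling y k) (+ k))
binom-pascal z -[1+ k ]  = refl

binom-zero : ∀ k → binom (+ 0) (+ suc k) ≡ 0ℚ
binom-zero k = ι-*-cancelʳ (suc k) (begin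
  binom (+ 0) (+ suc k) * ι (+ suc k)         ≡⟨ ℚ.*-comm (binom (+ 0) (+ suc k)) (ι (+ suc k)) ⟩
  ι (+ suc k) * binom (+ 0) (+ suc k)         ≡⟨ binom-absorb (+ 0) (+ suc k) ⟩
  0ℚ * binom -[1+ 0 ] (+ k)                   ≡⟨ ℚ.*-zeroˡ (binom -[1+ 0 ] (+ k)) ⟩
  0ℚ                                          ≡⟨ ℚ.*-zeroˡ (ι (+ suc k)) ⟨
  0ℚ * ι (+ suc k)                            ∎)
  where open ≡-Reasoning

-- Pascal's rule replaces C(z-1,k) by C(z,k) - C(z-1,k-1), and absorption turns z times the last
-- term into k C(z,k).
binom-absorb-complement : ∀ z k → ι z * binom (z ℤ.- + 1) k ≡ ι (z ℤ.- k) * binom z k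
binom-absorb-complement z k = begin
  ι z * X                         ≡⟨ lemma (ι z) X Y ⟩
  ι z * (X + Y) - ι z * Y         ≡⟨ cong₂ (λ u v → ι z * u - v) (binom-pascal z k) (binom-absorb z k) ⟨
  ι z * B - ι k * B               ≡⟨ lemma′ (ι z) (ι k) B ⟩
  (ι z - ι k) * B                 ≡⟨ cong (_* B) (ι-- z k) ⟨
  ι (z ℤ.- k) * B                 ∎
  where
  open ≡-Reasoning
  X = binom (z ℤ.- + 1) k
  Y = binom (z ℤ.- + 1) (k ℤ.- + 1)
  B = binom z k
  lemma : ∀ u x y → u * x ≡ u * (x + y) - u * y
  lemma = solve-∀ ℚ-ring
  lemma′ : ∀ u v b → u * b - v * b ≡ (u - v) * b
  lemma′ = solve-∀ ℚ-ring

-- Cardinalities as rational numbers.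

Counted : {A : Set} → (A → Set) → ℚ → Set
Counted P q = ∃[ k ] (P HasCardinality k × + k / 1 ≡ q)

counted-≡ : {A : Set} {P : A → Set} {q r : ℚ} → q ≡ r → Counted P q → Counted P r
counted-≡ refl c = c

counted-cong : {A : Set} {P Q : A → Set} {q : ℚ} → (∀ x → P x ⇔ Q x) → Counted P q → Counted Q q
counted-cong P⇔Q (k , (xs , unique , mem , len) , eq) =
  k , (xs , unique , (λ x → mk⇔ (to (P⇔Q x) ∘ to (mem x)) (from (mem x) ∘ from (P⇔Q x))) , len) , eq

counted-∅ : {A : Set} {P : A → Set} → (∀ x → ¬ P x) → Counted P 0ℚ
counted-∅ ¬P = 0 , ([] , [] , (λ x → mk⇔ (λ ()) (⊥-elim ∘ ¬P x)) , refl) , refl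

counted-[_] : {A : Set} {P : A → Set} (x : A) → P x → (∀ y → P y → y ≡ x) → Counted P 1ℚ
counted-[_] {P = P} x px only =
  1 , (x ∷ [] , [] ∷ [] , (λ y → mk⇔ (λ { (here refl) → px }) (here ∘ only y)) , refl) , refl

-- Serves to strip the forced initial north steps: prepending a fixed prefix is injective, and every
-- path considered has that prefix.
counted-image : {A B : Set} {Q : B → Set} {q : ℚ} (f : A → B) → (∀ {x y} → f x ≡ f y → x ≡ y) →
                (∀ y → Q y → ∃[ x ] y ≡ f x) → Counted (Q ∘ f) q → Counted Q q
counted-image {Q = Q} f inj sur (k , (xs , unique , mem , len) , eq) =
  k , (map f xs , Unique.map⁺ inj unique , mem′ , trans (List.length-map f xs) len) , eq
  where
  mem′ : ∀ y → y ∈ map f xs ⇔ Q y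
  mem′ y = mk⇔ (λ y∈ → let x , x∈ , y≡ = ∈-map⁻ f y∈ in subst Q (sym y≡) (to (mem x) x∈))
               (λ qy → let x , y≡ = sur y qy in
                 subst (_∈ map f xs) (sym y≡) (∈-map⁺ f (from (mem x) (subst Q y≡ qy))))

-- The source of every recurrence: a nonempty word is classified by its first letter, and the two
-- classes are disjoint.
counted-step : {P : List Step → Set} {q r : ℚ} → ¬ P [] →
               Counted (P ∘ (N ∷_)) q → Counted (P ∘ (E ∷_)) r → Counted P (q + r)
counted-step {P} ¬[] (k , (xs , xs! , xs-mem , xs-len) , refl) (l , (ys , ys! , ys-mem , ys-len) , refl) =
  k ℕ.+ l , (map (N ∷_) xs ++ map (E ∷_) ys , unique , mem , len) , ι-+ (+ k) (+ l)
  where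
  unique : Unique (map (N ∷_) xs ++ map (E ∷_) ys)
  unique = Unique.++⁺ (Unique.map⁺ List.∷-injectiveʳ xs!) (Unique.map⁺ List.∷-injectiveʳ ys!)
    λ { (n∈ , e∈) → case-disjoint (∈-map⁻ (N ∷_) n∈) (∈-map⁻ (E ∷_) e∈) }
    where
    case-disjoint : ∀ {w} → ∃[ u ] (u ∈ xs × w ≡ N ∷ u) → ∃[ u ] (u ∈ ys × w ≡ E ∷ u) → _
    case-disjoint (_ , _ , refl) (_ , _ , ())
  fwd : ∀ w → w ∈ map (N ∷_) xs ++ map (E ∷_) ys → P w
  fwd w w∈ with ∈-++⁻ (map (N ∷_) xs) w∈
  ... | inj₁ n∈ = let u , u∈ , eq = ∈-map⁻ (N ∷_) n∈ in subst P (sym eq) (to (xs-mem u) u∈)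
  ... | inj₂ e∈ = let u , u∈ , eq = ∈-map⁻ (E ∷_) e∈ in subst P (sym eq) (to (ys-mem u) u∈)
  bwd : ∀ w → P w → w ∈ map (N ∷_) xs ++ map (E ∷_) ys
  bwd []      p = contradiction p ¬[]
  bwd (N ∷ w) p = ∈-++⁺ˡ (∈-map⁺ (N ∷_) (from (xs-mem w) p))
  bwd (E ∷ w) p = ∈-++⁺ʳ (map (N ∷_) xs) (∈-map⁺ (E ∷_) (from (ys-mem w) p))
  mem : ∀ w → w ∈ map (N ∷_) xs ++ map (E ∷_) ys ⇔ P w
  mem w = mk⇔ (fwd w) (bwd w)
  len : length (map (N ∷_) xs ++ map (E ∷_) ys) ≡ k ℕ.+ l
  len = trans (List.length-++ (map (N ∷_) xs))
    (cong₂ ℕ._+_ (trans (List.length-map (N ∷_) xs) xs-len) (trans (List.length-map (E ∷_) ys) ys-len))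

-- Completions of a path and their recurrence.

length-filter-∷ : {A : Set} {P : A → Set} (P? : Decidable P) (x : A) (xs : List A) →
  length (filter P? (x ∷ xs)) ≡ length (filter P? (x ∷ [])) ℕ.+ length (filter P? xs)
length-filter-∷ P? x xs with does (P? x)
... | true  = refl
... | false = refl

-- `valleysFrom` detects a valley by looking two letters ahead. Remembering the last step instead
-- lets a word be consumed one letter at a time: after E, the current point becomes a valley as soon
-- as N follows.
valleysAfter : Step → Point → List Step → List Point
valleysAfter E v (N ∷ w) = v ∷ valleysFrom (step v N) w
valleysAfter _ v w       = valleysFrom v w

valleysFrom-E : ∀ v w → valleysFrom v (E ∷ w) ≡ valleysAfter E (step v E) w
valleysFrom-E v []      = refl
valleysFrom-E v (N ∷ w) = refl
valleysFrom-E v (E ∷ w) = refl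

valleysAfter-E : ∀ s v w → valleysAfter s v (E ∷ w) ≡ valleysAfter E (step v E) w
valleysAfter-E N = valleysFrom-E
valleysAfter-E E = valleysFrom-E

valleysAfter-[] : ∀ s v → valleysAfter s v [] ≡ []
valleysAfter-[] N v = refl
valleysAfter-[] E v = refl

-- The number of completions from the top height: only east steps can follow, so there is one
-- completion and it has no valley. The first argument may be negative, because marks are subtracted
-- from it unconditionally.
indicator : ℤ → ℕ → ℚ
indicator (+ zero) zero = 1ℚ
indicator _        _    = 0ℚ

module _ (m n : ℕ) where

  Below : Point → Set
  Below (x , y) = x ≤ m ℕ.* y

  Ends : Point → List Step → Set
  Ends v w = foldl step v w ≡ (m ℕ.* n , n) × All Below (scanl step v w)

  ends-∷ : ∀ {v} → Below v → ∀ s w → Ends v (s ∷ w) ⇔ Ends (step v s) w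
  ends-∷ ok s w = mk⇔ (λ { (end , _ ∷ above) → end , above }) (λ { (end , above) → end , ok ∷ above })

  ends-below : ∀ {v} w → Ends v w → Below v
  ends-below []      (_ , ok ∷ _) = ok
  ends-below (_ ∷ _) (_ , ok ∷ _) = ok

  ends-≤ : ∀ {x y} w → Ends (x , y) w → x ≤ m ℕ.* n × y ≤ n
  ends-≤ []      (refl , _)      = ℕ.≤-refl , ℕ.≤-refl
  ends-≤ (N ∷ w) (end , _ ∷ ok) = let p , q = ends-≤ w (end , ok) in p , ℕ.<⇒≤ q
  ends-≤ (E ∷ w) (end , _ ∷ ok) = let p , q = ends-≤ w (end , ok) in ℕ.<⇒≤ p , q

  module _ {P : Point → Set} (P? : Decidable P) where

    #marked #returned : List Point → ℕ
    #marked   vs = length (filter P? vs)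
    #returned vs = length (filter (isReturn? m n) vs)

    -- w completes a path that has reached v, its last step being s; the valleys from v on
    -- (v itself included if it becomes one) are counted.  The first count is an integer so that a
    -- mark can be subtracted from it unconditionally.
    Tail : Step → Point → ℤ → ℕ → List Step → Set
    Tail s v a b w = Ends v w × + #marked (valleysAfter s v w) ≡ a × #returned (valleysAfter s v w) ≡ b

    tail-E : ∀ s {v a b} → Below v → ∀ w → Tail E (step v E) a b w ⇔ Tail s v a b (E ∷ w)
    tail-E s {v} ok w rewrite valleysAfter-E s v w =
      mk⇔ (λ { (ends , stats) → from (ends-∷ ok E w) ends , stats })
          (λ { (ends , stats) → to (ends-∷ ok E w) ends , stats })

    tail-NN : ∀ {v a b} → Below v → ∀ w → Tail N (step v N) a b w ⇔ Tail N v a b (N ∷ w)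
    tail-NN ok w =
      mk⇔ (λ { (ends , stats) → from (ends-∷ ok N w) ends , stats })
          (λ { (ends , stats) → to (ends-∷ ok N w) ends , stats })

    -- N after E makes `v` a valley. Its mark `δ` leaves the first count, while the hypothesis on
    -- `#returned` covers both situations: `b′` equals `b` off the line, and is one less on it.
    tail-EN : ∀ {v a b b′} (δ : ℤ) → Below v → + #marked (v ∷ []) ≡ δ →
              (∀ {vs} → #returned vs ≡ b′ ⇔ #returned (v ∷ vs) ≡ b) →
              ∀ w → Tail N (step v N) (a ℤ.- δ) b′ w ⇔ Tail E v a b (N ∷ w)
    tail-EN {v} {a} {b} δ ok refl returned w =
      mk⇔ (λ { (ends , marks , rets) → from (ends-∷ ok N w) ends , fwd marks , to returned rets })
          (λ { (ends , marks , rets) → to (ends-∷ ok N w) ends , bwd marks , from returned rets })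
      where
      vs = valleysFrom (step v N) w
      split : + #marked (v ∷ vs) ≡ δ ℤ.+ + #marked vs
      split = cong +_ (length-filter-∷ P? v vs)
      cancel₁ : ∀ a δ → δ ℤ.+ (a ℤ.- δ) ≡ a
      cancel₁ = ℤ-Solver.solve-∀
      cancel₂ : ∀ c δ → c ≡ δ ℤ.+ c ℤ.- δ
      cancel₂ = ℤ-Solver.solve-∀
      fwd : + #marked vs ≡ a ℤ.- δ → + #marked (v ∷ vs) ≡ a
      fwd eq = trans split (trans (cong (λ z → δ ℤ.+ z) eq) (cancel₁ a δ))
      bwd : + #marked (v ∷ vs) ≡ a → + #marked vs ≡ a ℤ.- δ
      bwd eq = trans (cancel₂ (+ #marked vs) δ) (cong (ℤ._- δ) (trans (sym split) eq))

    tail-replicate : ∀ t {x y a b} → Below (x , y) → ∀ w →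
                     Tail N (x , t ℕ.+ y) a b w ⇔ Tail N (x , y) a b (replicate t N ++ w)
    tail-replicate zero    ok w = mk⇔ id id
    tail-replicate (suc t) {x} {y} ok w rewrite sym (ℕ.+-suc t y) =
      mk⇔ (to (tail-NN ok _) ∘ to ih) (from ih ∘ from (tail-NN ok _))
      where
      ih = tail-replicate t (ℕ.≤-trans ok (ℕ.*-monoʳ-≤ m (ℕ.n≤1+n y))) w

    -- μ e is 1 or 0 according to whether a valley with e east steps still to come is marked.
    module _ .{{_ : NonZero m}} (μ : ℕ → ℤ)
             (#marked≡μ : ∀ {x y e} → x ℕ.+ suc e ≡ m ℕ.* n → + #marked ((x , y) ∷ []) ≡ μ (suc e))
             -- A proposed solution after a last step N or E, with `e` east and `r` north steps to
             -- come. The condition `m ℕ.* suc r ≤ e` says that an east step from `suc e` stays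
             -- weakly above the line. The last two equations treat a point on the line, where N is
             -- forced and uses up one return.
             (Fᴺ Fᴱ : ℕ → ℕ → ℤ → ℕ → ℚ)
             (Fᴺ-zero : ∀ e a b → Fᴺ e 0 a b ≡ indicator a b)
             (Fᴺ-suc : ∀ e r a b → m ℕ.* suc r ≤ e →
                       Fᴺ (suc e) (suc r) a b ≡ Fᴺ (suc e) r a b + Fᴱ e (suc r) a b)
             (Fᴱ-suc : ∀ e r a b → m ℕ.* suc r ≤ e →
                       Fᴱ (suc e) (suc r) a b ≡ Fᴺ (suc e) r (a ℤ.- μ (suc e)) b + Fᴱ e (suc r) a b)
             (Fᴱ-noReturn : ∀ r a → Fᴱ (m ℕ.* suc r) (suc r) a 0 ≡ 0ℚ)
             (Fᴱ-return : ∀ r a b → Fᴱ (m ℕ.* suc r) (suc r) a (suc b) ≡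
                          Fᴺ (m ℕ.* suc r) r (a ℤ.- μ (m ℕ.* suc r)) b)
             where

      split-height : ∀ {x y e r} → x ℕ.+ e ≡ m ℕ.* n → y ℕ.+ r ≡ n → x ℕ.+ e ≡ m ℕ.* y ℕ.+ m ℕ.* r
      split-height {y = y} {r = r} xe refl = trans xe (ℕ.*-distribˡ-+ m y r)

      below : ∀ {x y e r} → x ℕ.+ e ≡ m ℕ.* n → y ℕ.+ r ≡ n → m ℕ.* r ≤ e → Below (x , y)
      below {x} {y} {e} {r} xe yr h = ℕ.+-cancelʳ-≤ e x (m ℕ.* y)
        (ℕ.≤-trans (ℕ.≤-reflexive (split-height {x} {y} xe yr)) (ℕ.+-monoʳ-≤ (m ℕ.* y) h))

      m*r≤m*sr : ∀ r → m ℕ.* r ≤ m ℕ.* suc r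
      m*r≤m*sr r = ℕ.*-monoʳ-≤ m (ℕ.n≤1+n r)

      m*sr≢0 : ∀ r → ¬ m ℕ.* suc r ≤ 0
      m*sr≢0 r h = contradiction (ℕ.≤-trans (ℕ.m≤n*m (suc r) m) h) λ ()

      unfinished : ∀ s {x y a b r} → y ℕ.+ suc r ≡ n → ¬ Tail s (x , y) a b []
      unfinished s {y = y} {r = r} yr ((end , _) , _) =
        contradiction (ℕ.+-cancelˡ-≡ y (suc r) 0 (trans yr (trans (sym (,-injectiveʳ end)) (sym (ℕ.+-identityʳ y))))) λ ()

      tail-top : ∀ s e {x} a b → x ℕ.+ e ≡ m ℕ.* n → Counted (Tail s (x , n) a b) (indicator a b)
      tail-top s (suc e) {x} a b xe = counted-≡ (ℚ.+-identityˡ (indicator a b))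
        (counted-step (λ { ((end , _) , _) → short (,-injectiveˡ end) })
          (counted-∅ λ { w ((end , _ ∷ above) , _) → ℕ.1+n≰n (proj₂ (ends-≤ w (end , above))) })
          (counted-cong (tail-E s (subst (x ≤_) xe (ℕ.m≤m+n x (suc e))))
            (tail-top E e a b (trans (sym (ℕ.+-suc x e)) xe))))
        where
        short : ¬ x ≡ m ℕ.* n
        short eq = contradiction (ℕ.+-cancelˡ-≡ x (suc e) 0 (trans xe (trans (sym eq) (sym (ℕ.+-identityʳ x))))) λ ()
      tail-top s zero {x} a b xe with trans (sym (ℕ.+-identityʳ x)) xe
      ... | refl = final a b
        where
        only-[] : ∀ {a b} w → Tail s (m ℕ.* n , n) a b w → w ≡ []
        only-[] []      _                      = refl
        only-[] (N ∷ w) ((end , _ ∷ above) , _) = ⊥-elim (ℕ.1+n≰n (proj₂ (ends-≤ w (end , above))))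
        only-[] (E ∷ w) ((end , _ ∷ above) , _) = ⊥-elim (ℕ.1+n≰n (proj₁ (ends-≤ w (end , above))))
        no-valleys : valleysAfter s (m ℕ.* n , n) [] ≡ []
        no-valleys = valleysAfter-[] s (m ℕ.* n , n)
        stats : ∀ {a b} w → Tail s (m ℕ.* n , n) a b w → + 0 ≡ a × 0 ≡ b
        stats {a} {b} w tail@(_ , marks , rets) with only-[] w tail
        ... | refl = subst (λ vs → + #marked vs ≡ a × #returned vs ≡ b) no-valleys (marks , rets)
        final : ∀ a b → Counted (Tail s (m ℕ.* n , n) a b) (indicator a b)
        final (+ zero) zero = counted-[ [] ]
          ((refl , ℕ.≤-refl ∷ []) , cong (+_ ∘ #marked) no-valleys , cong #returned no-valleys) only-[]
        final (+ zero)  (suc b) = counted-∅ λ w tail → contradiction (proj₂ (stats w tail)) λ ()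
        final (+ suc a) b       = counted-∅ λ w tail → contradiction (proj₁ (stats w tail)) λ ()
        final -[1+ a ]  b       = counted-∅ λ w tail → contradiction (proj₁ (stats w tail)) λ ()

      -- After N the point lies strictly above the line, whence `suc e` east steps with
      -- `m ℕ.* r ≤ e`; after E it may lie on the line. The two statements are proved by mutual
      -- recursion on the steps to come.
      tailᴺ : ∀ e r {x y} a b → x ℕ.+ suc e ≡ m ℕ.* n → y ℕ.+ r ≡ n → m ℕ.* r ≤ e →
              Counted (Tail N (x , y) a b) (Fᴺ (suc e) r a b)
      tailᴱ : ∀ e r {x y} a b → suc x ℕ.+ e ≡ m ℕ.* n → y ℕ.+ suc r ≡ n → m ℕ.* suc r ≤ e →
              Counted (Tail E (suc x , y) a b) (Fᴱ e (suc r) a b)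

      tailᴺ e zero {x} {y} a b xe yr _ =
        counted-≡ (sym (Fᴺ-zero (suc e) a b))
          (subst (λ y → Counted (Tail N (x , y) a b) (indicator a b))
                 (sym (trans (sym (ℕ.+-identityʳ y)) yr)) (tail-top N (suc e) a b xe))
      tailᴺ e (suc r) {x} {y} a b xe yr h =
        counted-≡ (sym (Fᴺ-suc e r a b h))
          (counted-step (unfinished N yr)
            (counted-cong (tail-NN ok) (tailᴺ e r a b xe (trans (sym (ℕ.+-suc y r)) yr) (ℕ.≤-trans (m*r≤m*sr r) h)))
            (counted-cong (tail-E N ok) (tailᴱ e r a b (trans (sym (ℕ.+-suc x e)) xe) yr h)))
        where
        ok : Below (x , y)
        ok = below xe yr (ℕ.m≤n⇒m≤1+n h)

      tailᴱ zero    r a b xe yr h = contradiction h (m*sr≢0 r)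
      tailᴱ (suc e) r {x} {y} a b xe yr h with m ℕ.* suc r ℕ.≤? e
      ... | yes h′ =
        counted-≡ (sym (Fᴱ-suc e r a b h′))
          (counted-step (unfinished E yr)
            (counted-cong (tail-EN (μ (suc e)) ok (#marked≡μ xe) not-return)
              (tailᴺ e r (a ℤ.- μ (suc e)) b xe (trans (sym (ℕ.+-suc y r)) yr) (ℕ.≤-trans (m*r≤m*sr r) h′)))
            (counted-cong (tail-E E ok) (tailᴱ e r a b (trans (sym (ℕ.+-suc (suc x) e)) xe) yr h′)))
        where
        ok : Below (suc x , y)
        ok = below xe yr h
        off-diagonal : ¬ IsReturn m n (suc x , y)
        off-diagonal (i , _ , _ , eq) = ℕ.<-irrefl
          (sym (ℕ.+-cancelˡ-≡ (suc x) (suc e) (m ℕ.* suc r)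
            (trans (split-height {suc x} {y} xe yr) (cong (ℕ._+ m ℕ.* suc r) (sym x≡)))))
          (s≤s h′)
          where
          x≡ : suc x ≡ m ℕ.* y
          x≡ = trans (,-injectiveˡ eq) (cong (m ℕ.*_) (sym (,-injectiveʳ eq)))
        not-return : ∀ {vs} → #returned vs ≡ b ⇔ #returned ((suc x , y) ∷ vs) ≡ b
        not-return {vs} rewrite List.filter-reject (isReturn? m n) {xs = vs} off-diagonal = mk⇔ id id
      -- The point is on the line: E would cross it, and N makes it a return. Hence nothing is
      -- counted when no return is allowed, and otherwise one return is removed.
      ... | no ¬h = counted-≡ (total b) (counted-step (unfinished E yr) (north b) (counted-∅ east))
        where
        ok : Below (suc x , y)
        ok = below xe yr h
        e≡ : m ℕ.* suc r ≡ suc e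
        e≡ = ℕ.≤-antisym h (ℕ.≰⇒> ¬h)
        diagonal : suc x ≡ m ℕ.* y
        diagonal = ℕ.+-cancelʳ-≡ (suc e) (suc x) (m ℕ.* y)
          (trans (split-height {suc x} {y} xe yr) (cong (m ℕ.* y ℕ.+_) e≡))
        y≥1 : ∀ {y} → suc x ≡ m ℕ.* y → 1 ≤ y
        y≥1 {zero}  eq = contradiction (trans eq (ℕ.*-zeroʳ m)) λ ()
        y≥1 {suc y} eq = s≤s z≤n
        -- Both endpoints of the path are excluded: the abscissa is positive, so `y` is, and a north
        -- step is still to come, so `y` is below `n`.
        is-return : IsReturn m n (suc x , y)
        is-return = y , y≥1 diagonal , subst (y <_) yr (ℕ.m<m+n y (s≤s z≤n)) , cong (_, y) diagonal
        returned : ∀ vs → #returned ((suc x , y) ∷ vs) ≡ suc (#returned vs)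
        returned vs = cong length (List.filter-accept (isReturn? m n) {xs = vs} is-return)
        east : ∀ w → ¬ Tail E (suc x , y) a b (E ∷ w)
        east w (ends , _) = ℕ.1+n≰n (subst (suc (suc x) ≤_) (sym diagonal) (ends-below w (to (ends-∷ ok E w) ends)))
        north-value : ℕ → ℚ
        north-value zero    = 0ℚ
        north-value (suc b) = Fᴺ (suc e) r (a ℤ.- μ (suc e)) b
        north : ∀ b → Counted (Tail E (suc x , y) a b ∘ (N ∷_)) (north-value b)
        north zero    = counted-∅ λ { w (_ , _ , rets) → contradiction (trans (sym (returned _)) rets) λ () }
        north (suc b) = counted-cong
          (tail-EN (μ (suc e)) ok (#marked≡μ xe)
            (λ {vs} → mk⇔ (trans (returned vs) ∘ cong suc) (ℕ.suc-injective ∘ trans (sym (returned vs)))))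
          -- Since m > 0, the north step leaves the line: m r < m (r+1) = e+1.
          (tailᴺ e r (a ℤ.- μ (suc e)) b xe (trans (sym (ℕ.+-suc y r)) yr)
            (ℕ.+-cancelˡ-≤ 1 _ _ (ℕ.≤-trans (ℕ.m<m+n (m ℕ.* r) (ℕ.>-nonZero⁻¹ m))
              (ℕ.≤-reflexive (trans (ℕ.+-comm (m ℕ.* r) m) (trans (sym (ℕ.*-suc m r)) e≡))))))
        total : ∀ b → north-value b + 0ℚ ≡ Fᴱ (suc e) (suc r) a b
        total b = trans (ℚ.+-identityʳ (north-value b)) (value b)
          where
          value : ∀ b → north-value b ≡ Fᴱ (suc e) (suc r) a b
          value zero    = sym (subst (λ e → Fᴱ e (suc r) a 0 ≡ 0ℚ) e≡ (Fᴱ-noReturn r a))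
          value (suc b) = sym (subst (λ e → Fᴱ e (suc r) a (suc b) ≡ Fᴺ e r (a ℤ.- μ e) b) e≡ (Fᴱ-return r a b))

      -- Strip the `t` initial north steps. As t > 0, the last of them is an N and m (n-t) < m n, so
      -- the remainder is a completion of the kind counted by `tailᴺ`.
      dyck-counted : .{{_ : NonZero n}} → ∀ t .{{_ : NonZero t}} → t ≤ n → ∀ a b →
        Counted (λ w → IsDyckPath m t n w × + #marked (valleys w) ≡ a × #returns m n w ≡ b)
                (Fᴺ (m ℕ.* n) (n ∸ t) a b)
      dyck-counted t t≤n a b =
        counted-image (replicate t N ++_) (List.++-cancelˡ (replicate t N) _ _)
          (λ { w (path , _) → strip t (IsDyckPath.starts path) })
          (counted-cong dyck⇔tail (start (m ℕ.* n) refl))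
        where
        strip : ∀ t {w} → Prefix _≡_ (replicate t N) w → ∃[ u ] w ≡ replicate t N ++ u
        strip zero    {w} []           = w , refl
        strip (suc t)     (refl ∷ pre) = let u , eq = strip t pre in u , cong (N ∷_) eq
        prefix : ∀ t u → Prefix _≡_ (replicate t N) (replicate t N ++ u)
        prefix zero    u = []
        prefix (suc t) u = refl ∷ prefix t u
        origin-below : Below (0 , 0)
        origin-below = z≤n
        dyck⇔tail : ∀ u → Tail N (0 , t ℕ.+ 0) a b u ⇔
          (IsDyckPath m t n (replicate t N ++ u) × + #marked (valleys (replicate t N ++ u)) ≡ a
                                                 × #returns m n (replicate t N ++ u) ≡ b)
        dyck⇔tail u = mk⇔
          (λ tail → let (end , above) , stats = to (tail-replicate t origin-below u) tail in
            record { ends = end ; starts = prefix t u ; above = All.map id above } , stats)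
          (λ { (path , stats) → from (tail-replicate t origin-below u)
            ((IsDyckPath.ends path , All.map id (IsDyckPath.above path)) , stats) })
        start : ∀ e → e ≡ m ℕ.* n → Counted (Tail N (0 , t ℕ.+ 0) a b) (Fᴺ e (n ∸ t) a b)
        start zero    eq = contradiction (sym eq) (ℕ.≢-nonZero⁻¹ (m ℕ.* n) {{ℕ.m*n≢0 m n}})
        start (suc e) eq rewrite ℕ.+-identityʳ t = tailᴺ e (n ∸ t) a b eq (ℕ.m+[n∸m]≡n t≤n)
          (ℕ.+-cancelˡ-≤ 1 _ _ (ℕ.≤-trans (ℕ.*-monoʳ-< m (ℕ.∸-monoʳ-< (ℕ.>-nonZero⁻¹ t) t≤n)) (ℕ.≤-reflexive (sym eq))))

-- The solutions: two-term expressions in binomial coefficients.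

module _ (m : ℕ) where

  -- Opaque, so that the arguments can be inferred.
  opaque

    T : ℚ → ℚ → ℤ → ℤ → ℚ
    T p q z k = p * binom z k - ι (+ m) * q * binom (z ℤ.- + 1) (k ℤ.- + 1)

    T-def : ∀ p q z k → T p q z k ≡ p * binom z k - ι (+ m) * q * binom (z ℤ.- + 1) (k ℤ.- + 1)
    T-def p q z k = refl

    -- The index pairs (z,k) and (z-1,k-1) of the two terms shift in parallel, so Pascal's rule
    -- applies to both at once with fixed coefficients.
    T-pascal : ∀ p q z k → T p q z k ≡ T p q (z ℤ.- + 1) (k ℤ.- + 1) + T p q (z ℤ.- + 1) k
    T-pascal p q z k = trans
      (cong₂ (λ u v → p * u - ι (+ m) * q * v) (binom-pascal z k) (binom-pascal (z ℤ.- + 1) (k ℤ.- + 1)))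
      (lemma p (ι (+ m) * q) (binom (z ℤ.- + 1) k) (binom (z ℤ.- + 1) (k ℤ.- + 1))
         (binom (z ℤ.- + 1 ℤ.- + 1) (k ℤ.- + 1)) (binom (z ℤ.- + 1 ℤ.- + 1) (k ℤ.- + 1 ℤ.- + 1)))
      where
      lemma : ∀ p q x y x′ y′ → p * (x + y) - q * (x′ + y′) ≡ (p * y - q * y′) + (p * x - q * x′)
      lemma = solve-∀ ℚ-ring

    T-+ : ∀ {p p₁ p₂ q q₁ q₂} z k → p ≡ p₁ + p₂ → q ≡ q₁ + q₂ → T p q z k ≡ T p₁ q₁ z k + T p₂ q₂ z k
    T-+ {p₁ = p₁} {p₂} {q₁ = q₁} {q₂} z k refl refl =
      lemma p₁ p₂ (ι (+ m)) q₁ q₂ (binom z k) (binom (z ℤ.- + 1) (k ℤ.- + 1))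
      where
      lemma : ∀ p₁ p₂ m q₁ q₂ x y →
        (p₁ + p₂) * x - m * (q₁ + q₂) * y ≡ (p₁ * x - m * q₁ * y) + (p₂ * x - m * q₂ * y)
      lemma = solve-∀ ℚ-ring

    T-≡0 : ∀ {p q z k} → p * binom z k ≡ 0ℚ → q * binom (z ℤ.- + 1) (k ℤ.- + 1) ≡ 0ℚ → T p q z k ≡ 0ℚ
    T-≡0 {p} {q} {z} {k} eq₁ eq₂ = begin
      T p q z k                   ≡⟨ cong₂ _-_ eq₁ (trans (ℚ.*-assoc (ι (+ m)) q _) (cong (ι (+ m) *_) eq₂)) ⟩
      0ℚ - ι (+ m) * 0ℚ           ≡⟨ cong (λ u → 0ℚ - u) (ℚ.*-zeroʳ (ι (+ m))) ⟩
      0ℚ                          ∎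
      where open ≡-Reasoning

    T-one : ∀ q z → T 1ℚ q z (+ 0) ≡ 1ℚ
    T-one q z = trans (cong (λ u → 1ℚ - u) (ℚ.*-zeroʳ (ι (+ m) * q))) refl

  -- At z = m r absorption gives m r C(z-1,k-1) = k C(z,k). So r times the expression is (r p - k q)
  -- C(z,k), which is zero by hypothesis.
  T-vanish : ∀ r .{{_ : NonZero r}} {p q} k → ι (+ r) * p ≡ ι k * q → T p q (+ (m ℕ.* r)) k ≡ 0ℚ
  T-vanish r {p} {q} k eq = ι-*-cancelʳ r (begin
    T p q z k * ι (+ r)                           ≡⟨ cong (_* ι (+ r)) (T-def p q z k) ⟩
    (p * X - ι (+ m) * q * Y) * ι (+ r)           ≡⟨ lemma p X (ι (+ m)) q Y (ι (+ r)) ⟩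
    ι (+ r) * p * X - q * (ι (+ m) * ι (+ r) * Y) ≡⟨ cong₂ (λ u v → u * X - q * (v * Y)) eq
                                                       (sym (trans (cong ι (ℤ.pos-* m r)) (ι-* (+ m) (+ r)))) ⟩
    ι k * q * X - q * (ι z * Y)                   ≡⟨ cong (λ u → ι k * q * X - q * u) (binom-absorb z k) ⟨
    ι k * q * X - q * (ι k * X)                   ≡⟨ lemma′ (ι k) q X (ι (+ r)) ⟩
    0ℚ * ι (+ r)                                  ∎)
    where
    open ≡-Reasoning
    z = + (m ℕ.* r)
    X = binom z k
    Y = binom (z ℤ.- + 1) (k ℤ.- + 1)
    lemma : ∀ p x m q y r → (p * x - m * q * y) * r ≡ r * p * x - q * (m * r * y)
    lemma = solve-∀ ℚ-ring
    lemma′ : ∀ k q x r → k * q * x - q * (k * x) ≡ 0ℚ * r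
    lemma′ = solve-∀ ℚ-ring

  T-negative : ∀ p q z {k} → k ℤ.< + 0 → T p q z k ≡ 0ℚ
  T-negative p q z { -[1+ k ]} _ = T-≡0 {p} {q} {z} { -[1+ k ]} (ℚ.*-zeroʳ p) (ℚ.*-zeroʳ q)
  T-negative p q z {+ k} (ℤ.+<+ ())

  -- The number of return-free tails with c east steps, d marked columns and ρ north steps to come
  -- and with a marked valleys, in parts (ii) and (iii).
  V : (c d ρ a : ℤ) → ℚ
  V c d ρ a = T (binom (d ℤ.- + 1) a) (binom d a) (c ℤ.- d ℤ.+ ρ) (ρ ℤ.- a)

  -- An unmarked column: leaving it lowers c - d by one, so Pascal's rule is applied to the factors
  -- that depend on z = c - d + ρ.
  V-row : ∀ c d ρ a → V (+ 1 ℤ.+ c) d ρ a ≡ V (+ 1 ℤ.+ c) d (ρ ℤ.- + 1) a + V c d ρ a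
  V-row c d ρ a = trans (T-pascal p q _ _)
    (cong₂ _+_ (cong₂ (T p q) (z₁ c d ρ) (k₁ ρ a)) (cong (λ z → T p q z (ρ ℤ.- a)) (z₂ c d ρ)))
    where
    p = binom (d ℤ.- + 1) a
    q = binom d a
    z₁ : ∀ c d ρ → + 1 ℤ.+ c ℤ.- d ℤ.+ ρ ℤ.- + 1 ≡ + 1 ℤ.+ c ℤ.- d ℤ.+ (ρ ℤ.- + 1)
    z₁ = ℤ-Solver.solve-∀
    k₁ : ∀ ρ a → ρ ℤ.- a ℤ.- + 1 ≡ ρ ℤ.- + 1 ℤ.- a
    k₁ = ℤ-Solver.solve-∀
    z₂ : ∀ c d ρ → + 1 ℤ.+ c ℤ.- d ℤ.+ ρ ℤ.- + 1 ≡ c ℤ.- d ℤ.+ ρ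
    z₂ = ℤ-Solver.solve-∀

  -- A marked column: c - d + ρ and ρ - a agree in all three terms, so Pascal's rule is applied to
  -- the coefficients, whose arguments are `d` and `a`.
  V-markedRow : ∀ c d ρ a →
    V (+ 1 ℤ.+ c) (+ 1 ℤ.+ d) ρ a ≡ V (+ 1 ℤ.+ c) d (ρ ℤ.- + 1) (a ℤ.- + 1) + V c d ρ a
  V-markedRow c d ρ a = trans
    (T-+ (+ 1 ℤ.+ c ℤ.- (+ 1 ℤ.+ d) ℤ.+ ρ) (ρ ℤ.- a)
      (trans (cong (λ d → binom d a) (d-eq d)) (pascal d))
      (trans (pascal (+ 1 ℤ.+ d)) (cong₂ (λ u v → binom u (a ℤ.- + 1) + binom v a) (d-eq d) (d-eq d))))
    (cong₂ _+_ (cong₂ (T _ _) (z₁ c d ρ) (k₁ ρ a)) (cong (λ z → T _ _ z (ρ ℤ.- a)) (z₂ c d ρ)))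
    where
    pascal : ∀ d → binom d a ≡ binom (d ℤ.- + 1) (a ℤ.- + 1) + binom (d ℤ.- + 1) a
    pascal d = trans (binom-pascal d a) (ℚ.+-comm (binom (d ℤ.- + 1) a) (binom (d ℤ.- + 1) (a ℤ.- + 1)))
    d-eq : ∀ d → + 1 ℤ.+ d ℤ.- + 1 ≡ d
    d-eq = ℤ-Solver.solve-∀
    z₁ : ∀ c d ρ → + 1 ℤ.+ c ℤ.- (+ 1 ℤ.+ d) ℤ.+ ρ ≡ + 1 ℤ.+ c ℤ.- d ℤ.+ (ρ ℤ.- + 1)
    z₁ = ℤ-Solver.solve-∀
    k₁ : ∀ ρ a → ρ ℤ.- a ≡ ρ ℤ.- + 1 ℤ.- (a ℤ.- + 1)
    k₁ = ℤ-Solver.solve-∀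
    z₂ : ∀ c d ρ → + 1 ℤ.+ c ℤ.- (+ 1 ℤ.+ d) ℤ.+ ρ ≡ c ℤ.- d ℤ.+ ρ
    z₂ = ℤ-Solver.solve-∀

  -- With no north step left and `b` returns still owed, ρ is -b. The lower index -b - a is then
  -- negative unless a = b = 0 or a < 0, and in the last case both coefficients vanish.
  V-zero : ∀ c d a b → V c d (+ 0 ℤ.- + b) a ≡ indicator a b
  V-zero c d (+ zero)  zero    = T-one 1ℚ (c ℤ.- d ℤ.+ + 0)
  V-zero c d (+ zero)  (suc b) = T-negative 1ℚ 1ℚ _ ℤ.-<+
  V-zero c d (+ suc a) zero    = T-negative (binom (d ℤ.- + 1) (+ suc a)) (binom d (+ suc a)) (c ℤ.- d ℤ.+ + 0) ℤ.-<+
  V-zero c d (+ suc a) (suc b) = T-negative (binom (d ℤ.- + 1) (+ suc a)) (binom d (+ suc a)) (c ℤ.- d ℤ.+ _) ℤ.-<+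
  V-zero c d -[1+ a ]  b       = T-≡0 {_} {_} {z} {k} (ℚ.*-zeroˡ (binom z k)) (ℚ.*-zeroˡ (binom (z ℤ.- + 1) (k ℤ.- + 1)))
    where
    z = c ℤ.- d ℤ.+ (+ 0 ℤ.- + b)
    k = + 0 ℤ.- + b ℤ.- -[1+ a ]

  -- Here z = m r, and the condition of `T-vanish` is r C(r-1,a) = (r-a) C(r,a).
  V-vanish : ∀ r .{{_ : NonZero r}} a → V (+ (m ℕ.* r)) (+ r) (+ r) a ≡ 0ℚ
  V-vanish r a = trans
    (cong (λ z → T (binom (+ r ℤ.- + 1) a) (binom (+ r) a) z (+ r ℤ.- a)) (z-eq (+ (m ℕ.* r)) (+ r)))
    (T-vanish r (+ r ℤ.- a) (binom-absorb-complement (+ r) a))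
    where
    z-eq : ∀ c r → c ℤ.- r ℤ.+ r ≡ c
    z-eq = ℤ-Solver.solve-∀

  -- The numbers of tails in part (i), after a last step N and E respectively.
  Uᴺ Uᴱ : (e r a b : ℤ) → ℚ
  Uᴺ e r a b = T (binom r a) (binom (r ℤ.+ + 1) (a ℤ.+ + 1)) (e ℤ.- b ℤ.- + 1) (a ℤ.- b)
  Uᴱ e r a b = T (binom (r ℤ.- + 1) (a ℤ.- + 1)) (binom r a) (e ℤ.- b) (a ℤ.- b)

  -- The upper index 1+e-b-1 after N equals the index e-b after E, so Pascal's rule acts on the
  -- coefficients only.
  Uᴺ-step : ∀ e r a b → Uᴺ (+ 1 ℤ.+ e) r a b ≡ Uᴺ (+ 1 ℤ.+ e) (r ℤ.- + 1) a b + Uᴱ e r a b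
  Uᴺ-step e r a b = trans
    (T-+ (+ 1 ℤ.+ e ℤ.- b ℤ.- + 1) (a ℤ.- b) (binom-pascal r a)
      (trans (binom-pascal (r ℤ.+ + 1) (a ℤ.+ + 1))
        (cong₂ _+_ (cong (λ r → binom r (a ℤ.+ + 1)) (r-eq₁ r)) (cong₂ binom (r-eq₂ r) (r-eq₂ a)))))
    (cong (λ z → Uᴺ (+ 1 ℤ.+ e) (r ℤ.- + 1) a b + T _ _ z (a ℤ.- b)) (z-eq e b))
    where
    r-eq₁ : ∀ r → r ℤ.+ + 1 ℤ.- + 1 ≡ r ℤ.- + 1 ℤ.+ + 1
    r-eq₁ = ℤ-Solver.solve-∀
    r-eq₂ : ∀ r → r ℤ.+ + 1 ℤ.- + 1 ≡ r
    r-eq₂ = ℤ-Solver.solve-∀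
    z-eq : ∀ e b → + 1 ℤ.+ e ℤ.- b ℤ.- + 1 ≡ e ℤ.- b
    z-eq = ℤ-Solver.solve-∀

  -- Written with the coefficients of `Uᴱ`, the value after a valley's north step has z and k both
  -- lowered by one. Off the line this is a summand of Pascal's rule; on the line it is the effect
  -- of replacing b by b+1 in `Uᴱ`.
  Uᴺ-return : ∀ e r a b → Uᴺ e (r ℤ.- + 1) (a ℤ.- + 1) b ≡
    T (binom (r ℤ.- + 1) (a ℤ.- + 1)) (binom r a) (e ℤ.- b ℤ.- + 1) (a ℤ.- b ℤ.- + 1)
  Uᴺ-return e r a b = cong₂ (λ q k → T (binom (r ℤ.- + 1) (a ℤ.- + 1)) q (e ℤ.- b ℤ.- + 1) k)
    (cong₂ binom (r-eq r) (r-eq a)) (k-eq a b)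
    where
    r-eq : ∀ r → r ℤ.- + 1 ℤ.+ + 1 ≡ r
    r-eq = ℤ-Solver.solve-∀
    k-eq : ∀ a b → a ℤ.- + 1 ℤ.- b ≡ a ℤ.- b ℤ.- + 1
    k-eq = ℤ-Solver.solve-∀

  Uᴱ-step : ∀ e r a b → Uᴱ (+ 1 ℤ.+ e) r a b ≡ Uᴺ (+ 1 ℤ.+ e) (r ℤ.- + 1) (a ℤ.- + 1) b + Uᴱ e r a b
  Uᴱ-step e r a b = trans (T-pascal p q (+ 1 ℤ.+ e ℤ.- b) (a ℤ.- b))
    (cong₂ _+_ (sym (Uᴺ-return (+ 1 ℤ.+ e) r a b)) (cong (λ z → T p q z (a ℤ.- b)) (z-eq e b)))
    where
    p = binom (r ℤ.- + 1) (a ℤ.- + 1)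
    q = binom r a
    z-eq : ∀ e b → + 1 ℤ.+ e ℤ.- b ℤ.- + 1 ≡ e ℤ.- b
    z-eq = ℤ-Solver.solve-∀

  Uᴱ-return : ∀ e r a b → Uᴱ e r a (+ 1 ℤ.+ b) ≡ Uᴺ e (r ℤ.- + 1) (a ℤ.- + 1) b
  Uᴱ-return e r a b = trans (cong₂ (T _ _) (eq e b) (eq a b)) (sym (Uᴺ-return e r a b))
    where
    eq : ∀ e b → e ℤ.- (+ 1 ℤ.+ b) ≡ e ℤ.- b ℤ.- + 1
    eq = ℤ-Solver.solve-∀

  -- The condition of `T-vanish` is here absorption itself, r C(r-1,a-1) = a C(r,a).
  Uᴱ-vanish : ∀ r .{{_ : NonZero r}} a → Uᴱ (+ (m ℕ.* r)) (+ r) a (+ 0) ≡ 0ℚ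
  Uᴱ-vanish r a = trans (cong₂ (T _ _) (ℤ.+-identityʳ _) (ℤ.+-identityʳ a))
    (T-vanish r a (sym (binom-absorb (+ r) a)))

  Uᴺ-zero : ∀ e a b → Uᴺ e (+ 0) a (+ b) ≡ indicator a b
  Uᴺ-zero e (+ zero)  zero    = T-one 1ℚ (e ℤ.- + 0 ℤ.- + 1)
  Uᴺ-zero e (+ zero)  (suc b) = T-negative 1ℚ 1ℚ (e ℤ.- + suc b ℤ.- + 1) ℤ.-<+
  Uᴺ-zero e (+ suc a) b       = T-≡0 {_} {_} {z} {k}
    (trans (cong (_* binom z k) (binom-zero a)) (ℚ.*-zeroˡ (binom z k)))
    (trans (cong (_* Y) binom-one) (ℚ.*-zeroˡ Y))
    where
    z = e ℤ.- + b ℤ.- + 1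
    k = + suc a ℤ.- + b
    Y = binom (z ℤ.- + 1) (k ℤ.- + 1)
    binom-one : binom (+ 0 ℤ.+ + 1) (+ suc a ℤ.+ + 1) ≡ 0ℚ
    binom-one = trans (cong (λ k → binom (+ 1) (+ suc k)) (ℕ.+-comm a 1))
      (trans (binom-pascal (+ 1) (+ suc (suc a))) (cong₂ _+_ (binom-zero (suc a)) (binom-zero a)))
  -- At a = -1 the second coefficient is C(1,0) = 1; the value is zero because the lower index a - b
  -- is negative.
  Uᴺ-zero e -[1+ a ]  zero    = T-negative 0ℚ (binom (+ 1) (-[1+ a ] ℤ.+ + 1)) (e ℤ.- + 0 ℤ.- + 1) ℤ.-<+
  Uᴺ-zero e -[1+ a ]  (suc b) = T-negative 0ℚ (binom (+ 1) (-[1+ a ] ℤ.+ + 1)) (e ℤ.- + suc b ℤ.- + 1) ℤ.-<+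

-- Marked columns: a residue class modulo m.

suc-/ : ∀ k m .{{_ : NonZero m}} →
        (m ∣ suc k × suc k ℕ./ m ≡ suc (k ℕ./ m)) ⊎ (¬ m ∣ suc k × suc k ℕ./ m ≡ k ℕ./ m)
suc-/ k m with ℕ.m≤n⇒m<n∨m≡n (m%n<n k m)
... | inj₂ eq = inj₁ (divides (suc q) suc-k , trans (/-congˡ {o = m} suc-k) (m*n/n≡m (suc q) m))
  where
  q = k ℕ./ m
  suc-k : suc k ≡ suc q ℕ.* m
  suc-k = trans (cong suc (m≡m%n+[m/n]*n k m)) (cong (ℕ._+ q ℕ.* m) eq)
... | inj₁ lt = inj₂ (not-divisible , (begin
    suc k ℕ./ m                                         ≡⟨ /-congˡ {o = m} suc-k ⟩
    (suc (k ℕ.% m) ℕ.+ q ℕ.* m) ℕ./ m                   ≡⟨ +-distrib-/-∣ʳ (suc (k ℕ.% m)) (n∣m*n q) ⟩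
    suc (k ℕ.% m) ℕ./ m ℕ.+ q ℕ.* m ℕ./ m               ≡⟨ cong₂ ℕ._+_ (m<n⇒m/n≡0 lt) (m*n/n≡m q m) ⟩
    q                                                   ∎))
  where
  open ≡-Reasoning
  q = k ℕ./ m
  suc-k : suc k ≡ suc (k ℕ.% m) ℕ.+ q ℕ.* m
  suc-k = cong suc (m≡m%n+[m/n]*n k m)
  not-divisible : ¬ m ∣ suc k
  not-divisible m∣ = >⇒∤ lt (∣m+n∣m⇒∣n (subst (m ∣_) (trans suc-k (ℕ.+-comm (suc (k ℕ.% m)) (q ℕ.* m))) m∣) (n∣m*n q))

module _ (m : ℕ) .{{_ : NonZero m}} (i : ℕ) where

  -- As x + e is a multiple of m, the residue of the column can be read from the number `e` of east
  -- steps still to come, the variable of the recurrence.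
  residue⇒∣ : ∀ {x e n} → x ℕ.+ e ≡ m ℕ.* n → x ℕ.% m ≡ i ℕ.% m → m ∣ e ℕ.+ i ℕ.% m
  residue⇒∣ {x} {e} {n} xe x%m = ∣m+n∣m⇒∣n (subst (m ∣_) (begin
    m ℕ.* n                                               ≡⟨ xe ⟨
    x ℕ.+ e                                               ≡⟨ cong (ℕ._+ e) (m≡m%n+[m/n]*n x m) ⟩
    x ℕ.% m ℕ.+ x ℕ./ m ℕ.* m ℕ.+ e                       ≡⟨ cong (λ ρ → ρ ℕ.+ x ℕ./ m ℕ.* m ℕ.+ e) x%m ⟩
    i ℕ.% m ℕ.+ x ℕ./ m ℕ.* m ℕ.+ e                       ≡⟨ cong (ℕ._+ e) (ℕ.+-comm (i ℕ.% m) (x ℕ./ m ℕ.* m)) ⟩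
    x ℕ./ m ℕ.* m ℕ.+ i ℕ.% m ℕ.+ e                       ≡⟨ ℕ.+-assoc (x ℕ./ m ℕ.* m) (i ℕ.% m) e ⟩
    x ℕ./ m ℕ.* m ℕ.+ (i ℕ.% m ℕ.+ e)                     ≡⟨ cong (x ℕ./ m ℕ.* m ℕ.+_) (ℕ.+-comm (i ℕ.% m) e) ⟩
    x ℕ./ m ℕ.* m ℕ.+ (e ℕ.+ i ℕ.% m)                     ∎) (m∣m*n n)) (n∣m*n (x ℕ./ m))
    where open ≡-Reasoning

  ∣⇒residue : ∀ {x e n} → x ℕ.+ e ≡ m ℕ.* n → m ∣ e ℕ.+ i ℕ.% m → x ℕ.% m ≡ i ℕ.% m
  ∣⇒residue {x} {e} {n} xe m∣ = begin
    x ℕ.% m                              ≡⟨ %-remove-+ʳ x m∣ ⟨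
    (x ℕ.+ (e ℕ.+ i ℕ.% m)) ℕ.% m        ≡⟨ cong (ℕ._% m) (trans (sym (ℕ.+-assoc x e (i ℕ.% m))) (cong (ℕ._+ i ℕ.% m) xe)) ⟩
    (m ℕ.* n ℕ.+ i ℕ.% m) ℕ.% m          ≡⟨ %-remove-+ˡ (i ℕ.% m) (m∣m*n n) ⟩
    i ℕ.% m ℕ.% m                        ≡⟨ m%n%n≡m%n i m ⟩
    i ℕ.% m                              ∎
    where open ≡-Reasoning

  -- The number of e′ with 0 < e′ ≤ e for which the columns m n − e′ are congruent to i modulo m.
  marksWithin : ℕ → ℕ
  marksWithin e = (e ℕ.+ i ℕ.% m) ℕ./ m

  marksWithin-suc : ∀ e → marksWithin (suc e) ≡ suc (marksWithin e) ⊎ marksWithin (suc e) ≡ marksWithin e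
  marksWithin-suc e with suc-/ (e ℕ.+ i ℕ.% m) m
  ... | inj₁ (_ , eq) = inj₁ eq
  ... | inj₂ (_ , eq) = inj₂ eq

  marksWithin-* : ∀ r → marksWithin (m ℕ.* r) ≡ r
  marksWithin-* r = begin
    (m ℕ.* r ℕ.+ i ℕ.% m) ℕ./ m              ≡⟨ +-distrib-/-∣ˡ (i ℕ.% m) (m∣m*n r) ⟩
    m ℕ.* r ℕ./ m ℕ.+ i ℕ.% m ℕ./ m          ≡⟨ cong₂ ℕ._+_ (trans (/-congˡ {o = m} (ℕ.*-comm m r)) (m*n/n≡m r m))
                                                  (m<n⇒m/n≡0 (m%n<n i m)) ⟩
    r ℕ.+ 0                                  ≡⟨ ℕ.+-identityʳ r ⟩
    r                                        ∎
    where open ≡-Reasoning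

  -- The quotient jumps exactly at multiples of m, by `suc-/`, and these correspond to the marked
  -- columns.
  mark : ∀ {x y e n} → x ℕ.+ suc e ≡ m ℕ.* n →
    + length (filter (isResidue? m i) ((x , y) ∷ [])) ≡ + marksWithin (suc e) ℤ.- + marksWithin e
  mark {x} {y} {e} xe with suc-/ (e ℕ.+ i ℕ.% m) m
  ... | inj₁ (m∣ , eq) = trans
    (cong (+_ ∘ length) (List.filter-accept (isResidue? m i) {x = x , y} (∣⇒residue xe m∣)))
    (sym (trans (cong (λ d → + d ℤ.- + marksWithin e) eq) (one (+ marksWithin e))))
    where
    one : ∀ d → + 1 ℤ.+ d ℤ.- d ≡ + 1
    one = ℤ-Solver.solve-∀
  ... | inj₂ (m∤ , eq) = trans
    (cong (+_ ∘ length) (List.filter-reject (isResidue? m i) {x = x , y} (m∤ ∘ residue⇒∣ xe)))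
    (sym (trans (cong (λ d → + d ℤ.- + marksWithin e) eq) (ℤ.+-inverseʳ (+ marksWithin e))))

  -- For i ≡ 0 the points of the line lie in marked columns, so leaving such a column uses up one of
  -- the r+1 marks given by `marksWithin-*`.
  marksWithin-pred : ∀ r → i ℕ.% m ≡ 0 → marksWithin (pred (m ℕ.* suc r)) ≡ r
  marksWithin-pred r i≡0 with m ℕ.* suc r in eq
  ... | zero = contradiction eq (ℕ.≢-nonZero⁻¹ (m ℕ.* suc r) {{ℕ.m*n≢0 m (suc r)}})
  ... | suc e with suc-/ (e ℕ.+ i ℕ.% m) m
  ...   | inj₁ (_ , eq′) = ℕ.suc-injective (trans (sym eq′) (trans (cong marksWithin (sym eq)) (marksWithin-* (suc r))))
  ...   | inj₂ (m∤ , _)  = contradiction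
      (subst (m ∣_) (trans eq (sym (trans (cong (suc e ℕ.+_) i≡0) (ℕ.+-identityʳ (suc e))))) (m∣m*n (suc r))) m∤

  -- For other residues the points of the line lie in unmarked columns: a mark there would make m
  -- divide `i ℕ.% m`, which is positive and smaller than m.
  marksWithin-pred′ : ∀ r → i ℕ.% m ≢ 0 → marksWithin (pred (m ℕ.* suc r)) ≡ suc r
  marksWithin-pred′ r i≢0 with m ℕ.* suc r in eq
  ... | zero = contradiction eq (ℕ.≢-nonZero⁻¹ (m ℕ.* suc r) {{ℕ.m*n≢0 m (suc r)}})
  ... | suc e with suc-/ (e ℕ.+ i ℕ.% m) m
  ...   | inj₂ (_ , eq′) = trans (sym eq′) (trans (cong marksWithin (sym eq)) (marksWithin-* (suc r)))
  ...   | inj₁ (m∣ , _)  = contradiction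
      (∣m+n∣m⇒∣n m∣ (subst (m ∣_) eq (m∣m*n (suc r))))
      (>⇒∤ {{ℕ.≢-nonZero i≢0}} (m%n<n i m))

  -- κ = 1 if returns are marked, κ = 0 if not.
  module Marked (n : ℕ) (κ : ℤ) (marks-pred : ∀ r → + marksWithin (pred (m ℕ.* suc r)) ≡ + suc r ℤ.- κ) where

    D : ℕ → ℤ
    D e = + marksWithin e

    μ : ℕ → ℤ
    μ e = D e ℤ.- D (pred e)

    -- A return costs one north step, and one marked column and one marked valley if it is marked.
    Vκ : ℕ → ℤ → ℕ → ℤ → ℕ → ℚ
    Vκ e d r a b = V m (+ e) (d ℤ.- κ ℤ.* + b) (+ r ℤ.- + b) (a ℤ.- κ ℤ.* + b)

    Vκ-row : ∀ e d r a b → Vκ (suc e) d (suc r) a b ≡ Vκ (suc e) d r a b + Vκ e d (suc r) a b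
    Vκ-row e d r a b = trans (V-row m (+ e) (d ℤ.- κ ℤ.* + b) (+ suc r ℤ.- + b) (a ℤ.- κ ℤ.* + b))
      (cong (λ ρ → V m (+ suc e) (d ℤ.- κ ℤ.* + b) ρ (a ℤ.- κ ℤ.* + b) + Vκ e d (suc r) a b) (eq (+ r) (+ b)))
      where
      eq : ∀ r b → + 1 ℤ.+ r ℤ.- b ℤ.- + 1 ≡ r ℤ.- b
      eq = ℤ-Solver.solve-∀

    Vκ-markedRow : ∀ e d r a b → Vκ (suc e) (+ 1 ℤ.+ d) (suc r) a b ≡ Vκ (suc e) d r (a ℤ.- + 1) b + Vκ e d (suc r) a b
    Vκ-markedRow e d r a b = trans
      (cong (λ d → V m (+ suc e) d (+ suc r ℤ.- + b) (a ℤ.- κ ℤ.* + b)) (eq₂ d (κ ℤ.* + b)))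
      (trans (V-markedRow m (+ e) (d ℤ.- κ ℤ.* + b) (+ suc r ℤ.- + b) (a ℤ.- κ ℤ.* + b))
      (cong₂ (λ ρ a′ → V m (+ suc e) (d ℤ.- κ ℤ.* + b) ρ a′ + Vκ e d (suc r) a b) (eq (+ r) (+ b)) (eq₃ a (κ ℤ.* + b))))
      where
      eq : ∀ r b → + 1 ℤ.+ r ℤ.- b ℤ.- + 1 ≡ r ℤ.- b
      eq = ℤ-Solver.solve-∀
      eq₂ : ∀ d u → + 1 ℤ.+ d ℤ.- u ≡ + 1 ℤ.+ (d ℤ.- u)
      eq₂ = ℤ-Solver.solve-∀
      eq₃ : ∀ a u → a ℤ.- u ℤ.- + 1 ≡ a ℤ.- + 1 ℤ.- u
      eq₃ = ℤ-Solver.solve-∀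

    -- After N the current column can contain no further valley, so only the columns to its right
    -- count; after E the current column counts too.
    Vᴺ Vᴱ : ℕ → ℕ → ℤ → ℕ → ℚ
    Vᴺ e = Vκ e (D (pred e))
    Vᴱ e = Vκ e (D e)

    Vκ-zero : ∀ e d a b → Vκ e d 0 a b ≡ indicator a b
    Vκ-zero e d a zero    = trans (V-zero m (+ e) (d ℤ.- κ ℤ.* + 0) (a ℤ.- κ ℤ.* + 0) 0)
      (cong (λ a → indicator a 0) (trans (cong (λ z → a ℤ.- z) (ℤ.*-zeroʳ κ)) (ℤ.+-identityʳ a)))
    Vκ-zero e d a (suc b) = trans (V-zero m (+ e) (d ℤ.- κ ℤ.* + suc b) (a ℤ.- κ ℤ.* + suc b) (suc b))
      (trans (indicator-suc (a ℤ.- κ ℤ.* + suc b)) (sym (indicator-suc a)))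
      where
      indicator-suc : ∀ a → indicator a (suc b) ≡ 0ℚ
      indicator-suc (+ zero)  = refl
      indicator-suc (+ suc _) = refl
      indicator-suc -[1+ _ ]  = refl

    Vᴱ-suc : ∀ e r a b → Vᴱ (suc e) (suc r) a b ≡ Vᴺ (suc e) r (a ℤ.- μ (suc e)) b + Vᴱ e (suc r) a b
    Vᴱ-suc e r a b with marksWithin-suc e
    ... | inj₁ eq = trans (cong (λ d → Vκ (suc e) (+ d) (suc r) a b) eq)
      (trans (Vκ-markedRow e (D e) r a b)
        (cong (λ δ → Vκ (suc e) (D e) r (a ℤ.- δ) b + Vᴱ e (suc r) a b)
          (sym (trans (cong (λ d → + d ℤ.- D e) eq) (one (D e))))))
      where
      one : ∀ d → + 1 ℤ.+ d ℤ.- d ≡ + 1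
      one = ℤ-Solver.solve-∀
    ... | inj₂ eq = trans (cong (λ d → Vκ (suc e) (+ d) (suc r) a b) eq)
      (trans (Vκ-row e (D e) r a b)
        (cong (λ a′ → Vκ (suc e) (D e) r a′ b + Vᴱ e (suc r) a b)
          (sym (trans (cong (λ d → a ℤ.- (+ d ℤ.- D e)) eq) (none a (D e))))))
      where
      none : ∀ a d → a ℤ.- (d ℤ.- d) ≡ a
      none = ℤ-Solver.solve-∀

    Vᴱ-noReturn : ∀ r a → Vᴱ (m ℕ.* suc r) (suc r) a 0 ≡ 0ℚ
    Vᴱ-noReturn r a = trans
      (trans (cong (λ ρ → V m (+ (m ℕ.* suc r)) (D (m ℕ.* suc r) ℤ.- κ ℤ.* + 0) ρ (a ℤ.- κ ℤ.* + 0)) (ℤ.+-identityʳ (+ suc r)))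
      (cong₂ (λ d a → V m (+ (m ℕ.* suc r)) d (+ suc r) a)
        (trans (no-κ (D (m ℕ.* suc r))) (cong +_ (marksWithin-* (suc r)))) (no-κ a)))
      (V-vanish m (suc r) a)
      where
      no-κ : ∀ z → z ℤ.- κ ℤ.* + 0 ≡ z
      no-κ z = trans (cong (λ u → z ℤ.- u) (ℤ.*-zeroʳ κ)) (ℤ.+-identityʳ z)

    -- Both sides are the same value of `V`: by `marks-pred` the mark of a point on the line is `κ`,
    -- which is what one more return subtracts from the marked columns and from the marked valleys.
    Vᴱ-return : ∀ r a b → Vᴱ (m ℕ.* suc r) (suc r) a (suc b) ≡ Vᴺ (m ℕ.* suc r) r (a ℤ.- μ (m ℕ.* suc r)) b
    Vᴱ-return r a b = trans
      (cong (λ d → Vκ e (+ d) (suc r) a (suc b)) (marksWithin-* (suc r)))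
      (trans (trans (cong (λ ρ → V m (+ e) (+ suc r ℤ.- κ ℤ.* + suc b) ρ (a ℤ.- κ ℤ.* + suc b)) (ρ-eq (+ r) (+ b)))
        (cong₂ (λ d a → V m (+ e) d (+ r ℤ.- + b) a) (d-eq (+ suc r) κ (+ b)) (a-eq (+ suc r) a κ (+ b))))
      (cong₂ (λ d δ → Vκ e d r (a ℤ.- δ) b) (sym (marks-pred r))
        (sym (cong₂ (λ d d′ → + d ℤ.- d′) (marksWithin-* (suc r)) (marks-pred r)))))
      where
      e = m ℕ.* suc r
      ρ-eq : ∀ r b → + 1 ℤ.+ r ℤ.- (+ 1 ℤ.+ b) ≡ r ℤ.- b
      ρ-eq = ℤ-Solver.solve-∀
      d-eq : ∀ d κ b → d ℤ.- κ ℤ.* (+ 1 ℤ.+ b) ≡ d ℤ.- κ ℤ.- κ ℤ.* b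
      d-eq = ℤ-Solver.solve-∀
      a-eq : ∀ d a κ b → a ℤ.- κ ℤ.* (+ 1 ℤ.+ b) ≡ a ℤ.- (d ℤ.- (d ℤ.- κ)) ℤ.- κ ℤ.* b
      a-eq = ℤ-Solver.solve-∀

    marked-counted : .{{_ : NonZero n}} → ∀ t .{{_ : NonZero t}} → t ≤ n → ∀ a b →
      Counted (λ w → IsDyckPath m t n w × + #valleys[ i mod m ] w ≡ a × #returns m n w ≡ b)
              (Vᴺ (m ℕ.* n) (n ∸ t) a b)
    marked-counted = dyck-counted m n (isResidue? m i) μ (λ {x} {y} {e} → mark {x} {y} {e}) Vᴺ Vᴱ
      (λ e → Vκ-zero e (D (pred e)))
      -- After N, all three terms involve the same marked columns `D e`, so the row is unmarked
      -- whatever the current column is.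
      (λ e r a b _ → Vκ-row e (D e) r a b)
      (λ e r a b _ → Vᴱ-suc e r a b)
      Vᴱ-noReturn Vᴱ-return

-- The counts at the start of a path, and their closed forms.

T-product : ∀ m n .{{_ : NonZero n}} {p q} s z k → ι (+ n) * p ≡ ι (s ℤ.+ k) * q → z ≡ + m ℤ.* + n ℤ.- s →
            T m p q z k ≡ s / n * q * binom (z ℤ.- + 1) k
-- With C(z,k) = X + Y and m n = z + s, multiplication by n leaves s q X + q (k C(z,k) - z Y), whose
-- second summand vanishes by absorption.
T-product m n {p} {q} s z k eq refl = ι-*-cancelʳ n (begin
  T m p q z k * ι (+ n)                                 ≡⟨ cong (_* ι (+ n)) (trans
    (T-def m p q z k) (cong (λ u → p * u - ι (+ m) * q * Y) (binom-pascal z k))) ⟩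
  (p * (X + Y) - ι (+ m) * q * Y) * ι (+ n)             ≡⟨ lemma₁ p q X Y (ι (+ m)) (ι (+ n)) ⟩
  ι (+ n) * p * (X + Y) - ι (+ m) * ι (+ n) * q * Y     ≡⟨ cong (λ u → u * (X + Y) - ι (+ m) * ι (+ n) * q * Y)
    (trans eq (cong (_* q) (ι-+ s k))) ⟩
  (ι s + ι k) * q * (X + Y) - ι (+ m) * ι (+ n) * q * Y ≡⟨ cong (λ u → (ι s + ι k) * q * (X + Y) - u * q * Y) mn ⟩
  (ι s + ι k) * q * (X + Y) - (ι z + ι s) * q * Y       ≡⟨ lemma₂ (ι s) (ι k) (ι z) q X Y ⟩
  ι s * q * X + q * (ι k * (X + Y) - ι z * Y)           ≡⟨ cong (λ u → ι s * q * X + q * (u - ι z * Y)) absorb ⟩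
  ι s * q * X + q * (ι z * Y - ι z * Y)                 ≡⟨ lemma₃ (ι s) q X (ι z * Y) ⟩
  ι s * q * X                                           ≡⟨ cong (λ u → u * q * X) (/-*-cancel s n) ⟨
  s / n * ι (+ n) * q * X                               ≡⟨ lemma₄ (s / n) (ι (+ n)) q X ⟩
  s / n * q * X * ι (+ n)                               ∎)
  where
  open ≡-Reasoning
  X = binom (z ℤ.- + 1) k
  Y = binom (z ℤ.- + 1) (k ℤ.- + 1)
  absorb : ι k * (X + Y) ≡ ι z * Y
  absorb = trans (cong (ι k *_) (sym (binom-pascal z k))) (binom-absorb z k)
  cancel : ∀ u s → u ≡ u ℤ.- s ℤ.+ s
  cancel = ℤ-Solver.solve-∀
  mn : ι (+ m) * ι (+ n) ≡ ι z + ι s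
  mn = trans (sym (ι-* (+ m) (+ n))) (trans (cong ι (cancel (+ m ℤ.* + n) s)) (ι-+ z s))
  lemma₁ : ∀ p q x y m n → (p * (x + y) - m * q * y) * n ≡ n * p * (x + y) - m * n * q * y
  lemma₁ = solve-∀ ℚ-ring
  lemma₂ : ∀ s k z q x y → (s + k) * q * (x + y) - (z + s) * q * y ≡ s * q * x + q * (k * (x + y) - z * y)
  lemma₂ = solve-∀ ℚ-ring
  lemma₃ : ∀ s q x y → s * q * x + q * (y - y) ≡ s * q * x
  lemma₃ = solve-∀ ℚ-ring
  lemma₄ : ∀ s n q x → s * n * q * x ≡ s * q * x * n
  lemma₄ = solve-∀ ℚ-ring

∸-as-minus : ∀ {t n} → t ≤ n → + (n ∸ t) ≡ + n ℤ.- + t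
∸-as-minus {t} {n} t≤n = sym (trans (ℤ.m-n≡m⊖n n t) (ℤ.⊖-≥ t≤n))

+-≡-⇔ : {A B : Set} {k a : ℕ} → (A × + k ≡ + a × B) ⇔ (A × k ≡ a × B)
+-≡-⇔ = mk⇔ (λ { (x , eq , y) → x , ℤ.+-injective eq , y }) (λ { (x , eq , y) → x , cong +_ eq , y })

U-counted : ∀ m n .{{_ : NonZero m}} .{{_ : NonZero n}} t .{{_ : NonZero t}} → t ≤ n → ∀ a b →
  Counted (λ w → IsDyckPath m t n w × + #valleys w ≡ a × #returns m n w ≡ b)
          (Uᴺ m (+ (m ℕ.* n)) (+ (n ∸ t)) a (+ b))
U-counted m n t t≤n a b = counted-cong
  (λ w → mk⇔ (λ { (x , eq , y) → x , trans (sym (all w)) eq , y }) (λ { (x , eq , y) → x , trans (all w) eq , y }))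
  -- Every valley is marked, so `μ` is constantly 1.
  (dyck-counted m n U? (λ _ → + 1) (λ _ → refl)
    (λ e r a b → Uᴺ m (+ e) (+ r) a (+ b)) (λ e r a b → Uᴱ m (+ e) (+ r) a (+ b))
    (λ e a b → Uᴺ-zero m (+ e) a b)
    (λ e r a b _ → Uᴺ-step m (+ e) (+ suc r) a (+ b))
    (λ e r a b _ → Uᴱ-step m (+ e) (+ suc r) a (+ b))
    (λ r a → Uᴱ-vanish m (suc r) a)
    (λ r a b → Uᴱ-return m (+ (m ℕ.* suc r)) (+ suc r) a (+ b))
    t t≤n a b)
  where
  all : ∀ w → + length (filter U? (valleys w)) ≡ + #valleys w
  all w = cong (+_ ∘ length) (List.filter-all U? (All.universal (λ _ → tt) (valleys w)))

theorem1p1 : (m n t : ℕ) .{{_ : NonZero m}} .{{_ : NonZero n}} .{{_ : NonZero t}} → t ≤ n →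
    ((a b : ℕ) → b ≤ a → a ≤ n ∸ t →
    ∃[ k ] ((λ w → IsDyckPath m t n w × #valleys w ≡ a × #returns m n w ≡ b) HasCardinality k
    × + k / 1 ≡
    binom (+ n ℤ.- + t) (+ a) * binom (+ m ℤ.* + n ℤ.- + b ℤ.- + 1) (+ a ℤ.- + b)
    - (+ m / 1) * binom (+ n ℤ.- + t ℤ.+ + 1) (+ a ℤ.+ + 1) * binom (+ m ℤ.* + n ℤ.- + b ℤ.- + 2) (+ a ℤ.- + b ℤ.- + 1)))
    × ((a b : ℕ) → b ≤ a → a ≤ n ∸ t →
    ∃[ k ] ((λ w → IsDyckPath m t n w × #valleys[ m mod m ] w ≡ a × #returns m n w ≡ b) HasCardinality k
    × + k / 1 ≡
    binom (+ n ℤ.- + b ℤ.- + 2) (+ a ℤ.- + b) * binom (+ m ℤ.* + n ℤ.- + t ℤ.+ + 1) (+ n ℤ.- + t ℤ.- + a)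
    - (+ m / 1) * binom (+ n ℤ.- + b ℤ.- + 1) (+ a ℤ.- + b) * binom (+ m ℤ.* + n ℤ.- + t) (+ n ℤ.- + t ℤ.- + a ℤ.- + 1)))
    × ((i : ℕ) → 1 ≤ i → i < m → (a b : ℕ) → a ℕ.+ b ≤ n ∸ t →
    ∃[ k ] ((λ w → IsDyckPath m t n w × #valleys[ i mod m ] w ≡ a × #returns m n w ≡ b) HasCardinality k
    × + k / 1 ≡
    ((+ t ℤ.+ + b) / n) * binom (+ n) (+ a) * binom (+ m ℤ.* + n ℤ.- + t ℤ.- + b ℤ.- + 1) (+ n ℤ.- + t ℤ.- + a ℤ.- + b)))
theorem1p1 m n@(suc n-1) t t≤n =
    (λ a b _ _ → counted-≡ (formula-i a b)
      (counted-cong (λ _ → +-≡-⇔) (U-counted m n t t≤n (+ a) b)))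
  , (λ a b _ _ → counted-≡ (formula-ii a b)
      (counted-cong (λ _ → +-≡-⇔) (marked-counted m m n (+ 1) pred-ii t t≤n (+ a) b)))
  , (λ i 1≤i i<m a b _ → counted-≡ (formula-iii i 1≤i i<m a b)
      (counted-cong (λ _ → +-≡-⇔) (marked-counted m i n (+ 0) (pred-iii i 1≤i i<m) t t≤n (+ a) b)))
  where
  open Marked
  open ≡-Reasoning
  r≡ : + (n ∸ t) ≡ + n ℤ.- + t
  r≡ = ∸-as-minus t≤n
  e≡ : + (m ℕ.* n) ≡ + m ℤ.* + n
  e≡ = ℤ.pos-* m n

  minus-2 : ∀ z → z ℤ.- + 1 ℤ.- + 1 ≡ z ℤ.- + 2
  minus-2 = ℤ-Solver.solve-∀

  formula-i : ∀ a b → Uᴺ m (+ (m ℕ.* n)) (+ (n ∸ t)) (+ a) (+ b) ≡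
    binom (+ n ℤ.- + t) (+ a) * binom (+ m ℤ.* + n ℤ.- + b ℤ.- + 1) (+ a ℤ.- + b)
    - (+ m / 1) * binom (+ n ℤ.- + t ℤ.+ + 1) (+ a ℤ.+ + 1) * binom (+ m ℤ.* + n ℤ.- + b ℤ.- + 2) (+ a ℤ.- + b ℤ.- + 1)
  formula-i a b = begin
    Uᴺ m (+ (m ℕ.* n)) (+ (n ∸ t)) (+ a) (+ b)
      ≡⟨ cong₂ (λ e r → Uᴺ m e r (+ a) (+ b)) e≡ r≡ ⟩
    T m p q z (+ a ℤ.- + b)
      ≡⟨ T-def m p q z (+ a ℤ.- + b) ⟩
    p * binom z (+ a ℤ.- + b) - ι (+ m) * q * binom (z ℤ.- + 1) (+ a ℤ.- + b ℤ.- + 1)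
      ≡⟨ cong (λ z′ → p * binom z (+ a ℤ.- + b) - ι (+ m) * q * binom z′ (+ a ℤ.- + b ℤ.- + 1))
           (minus-2 (+ m ℤ.* + n ℤ.- + b)) ⟩
    _ ∎
    where
    p = binom (+ n ℤ.- + t) (+ a)
    q = binom (+ n ℤ.- + t ℤ.+ + 1) (+ a ℤ.+ + 1)
    z = + m ℤ.* + n ℤ.- + b ℤ.- + 1

  -- Returns have abscissa divisible by m. Hence they are marked for i = m, giving κ = 1, and
  -- unmarked for 0 < i < m, giving κ = 0.
  pred-ii : ∀ r → + marksWithin m m (pred (m ℕ.* suc r)) ≡ + suc r ℤ.- + 1
  pred-ii r = cong +_ (marksWithin-pred m m r (n%n≡0 m))

  pred-iii : ∀ i → 1 ≤ i → i < m → ∀ r → + marksWithin m i (pred (m ℕ.* suc r)) ≡ + suc r ℤ.- + 0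
  pred-iii i 1≤i i<m r = trans
    (cong +_ (marksWithin-pred′ m i r λ eq → ℕ.<-irrefl (sym (trans (sym (m<n⇒m%n≡m i<m)) eq)) 1≤i))
    (sym (ℤ.+-identityʳ (+ suc r)))

  formula-ii : ∀ a b → Vᴺ m m n (+ 1) pred-ii (m ℕ.* n) (n ∸ t) (+ a) b ≡
    binom (+ n ℤ.- + b ℤ.- + 2) (+ a ℤ.- + b) * binom (+ m ℤ.* + n ℤ.- + t ℤ.+ + 1) (+ n ℤ.- + t ℤ.- + a)
    - (+ m / 1) * binom (+ n ℤ.- + b ℤ.- + 1) (+ a ℤ.- + b) * binom (+ m ℤ.* + n ℤ.- + t) (+ n ℤ.- + t ℤ.- + a ℤ.- + 1)
  formula-ii a b = begin
    V m (+ (m ℕ.* n)) (+ marksWithin m m (pred (m ℕ.* n)) ℤ.- + 1 ℤ.* + b) (+ (n ∸ t) ℤ.- + b) (+ a ℤ.- + 1 ℤ.* + b)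
      -- Of the n marked columns from 0 to m (n-1), column 0 is excluded, since the starting point
      -- of the tail follows an N; this leaves n - 1.
      ≡⟨ cong₂ (λ e d → V m e (d ℤ.- + 1 ℤ.* + b) (+ (n ∸ t) ℤ.- + b) (+ a ℤ.- + 1 ℤ.* + b)) e≡ (pred-ii n-1) ⟩
    V m (+ m ℤ.* + n) (+ n ℤ.- + 1 ℤ.- + 1 ℤ.* + b) (+ (n ∸ t) ℤ.- + b) (+ a ℤ.- + 1 ℤ.* + b)
      ≡⟨ cong (λ r → V m (+ m ℤ.* + n) (+ n ℤ.- + 1 ℤ.- + 1 ℤ.* + b) (r ℤ.- + b) (+ a ℤ.- + 1 ℤ.* + b)) r≡ ⟩
    V m (+ m ℤ.* + n) (+ n ℤ.- + 1 ℤ.- + 1 ℤ.* + b) (+ n ℤ.- + t ℤ.- + b) (+ a ℤ.- + 1 ℤ.* + b)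
      ≡⟨ cong₂ (λ d a → V m (+ m ℤ.* + n) d (+ n ℤ.- + t ℤ.- + b) a) (d-eq (+ n) (+ b)) (a-eq (+ a) (+ b)) ⟩
    V m (+ m ℤ.* + n) d (+ n ℤ.- + t ℤ.- + b) (+ a ℤ.- + b)
      ≡⟨ cong₂ (T m (binom (d ℤ.- + 1) (+ a ℤ.- + b)) (binom d (+ a ℤ.- + b)))
           (z-eq (+ m ℤ.* + n) (+ n) (+ t) (+ b)) (k-eq (+ n) (+ t) (+ a) (+ b)) ⟩
    T m (binom (d ℤ.- + 1) (+ a ℤ.- + b)) (binom d (+ a ℤ.- + b)) z k
      ≡⟨ T-def m (binom (d ℤ.- + 1) (+ a ℤ.- + b)) (binom d (+ a ℤ.- + b)) z k ⟩
    binom (d ℤ.- + 1) (+ a ℤ.- + b) * binom z k - ι (+ m) * binom d (+ a ℤ.- + b) * binom (z ℤ.- + 1) (k ℤ.- + 1)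
      ≡⟨ cong₂ (λ d′ z′ → binom d′ (+ a ℤ.- + b) * binom z k - ι (+ m) * binom d (+ a ℤ.- + b) * binom z′ (k ℤ.- + 1))
           (minus-2 (+ n ℤ.- + b)) (z-1 (+ m ℤ.* + n ℤ.- + t)) ⟩
    _ ∎
    where
    d = + n ℤ.- + b ℤ.- + 1
    z = + m ℤ.* + n ℤ.- + t ℤ.+ + 1
    k = + n ℤ.- + t ℤ.- + a
    d-eq : ∀ n b → n ℤ.- + 1 ℤ.- + 1 ℤ.* b ≡ n ℤ.- b ℤ.- + 1
    d-eq = ℤ-Solver.solve-∀
    a-eq : ∀ a b → a ℤ.- + 1 ℤ.* b ≡ a ℤ.- b
    a-eq = ℤ-Solver.solve-∀
    z-eq : ∀ e n t b → e ℤ.- (n ℤ.- b ℤ.- + 1) ℤ.+ (n ℤ.- t ℤ.- b) ≡ e ℤ.- t ℤ.+ + 1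
    z-eq = ℤ-Solver.solve-∀
    k-eq : ∀ n t a b → n ℤ.- t ℤ.- b ℤ.- (a ℤ.- b) ≡ n ℤ.- t ℤ.- a
    k-eq = ℤ-Solver.solve-∀
    z-1 : ∀ z → z ℤ.+ + 1 ℤ.- + 1 ≡ z
    z-1 = ℤ-Solver.solve-∀

  formula-iii : ∀ i 1≤i i<m a b → Vᴺ m i n (+ 0) (pred-iii i 1≤i i<m) (m ℕ.* n) (n ∸ t) (+ a) b ≡
    ((+ t ℤ.+ + b) / n) * binom (+ n) (+ a) * binom (+ m ℤ.* + n ℤ.- + t ℤ.- + b ℤ.- + 1) (+ n ℤ.- + t ℤ.- + a ℤ.- + b)
  formula-iii i 1≤i i<m a b = begin
    V m (+ (m ℕ.* n)) (+ marksWithin m i (pred (m ℕ.* n)) ℤ.- + 0 ℤ.* + b) (+ (n ∸ t) ℤ.- + b) (+ a ℤ.- + 0 ℤ.* + b)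
      ≡⟨ cong₂ (λ e d → V m e (d ℤ.- + 0 ℤ.* + b) (+ (n ∸ t) ℤ.- + b) (+ a ℤ.- + 0 ℤ.* + b)) e≡ (pred-iii i 1≤i i<m n-1) ⟩
    V m (+ m ℤ.* + n) (+ n ℤ.- + 0 ℤ.- + 0 ℤ.* + b) (+ (n ∸ t) ℤ.- + b) (+ a ℤ.- + 0 ℤ.* + b)
      ≡⟨ cong (λ r → V m (+ m ℤ.* + n) (+ n ℤ.- + 0 ℤ.- + 0 ℤ.* + b) (r ℤ.- + b) (+ a ℤ.- + 0 ℤ.* + b)) r≡ ⟩
    V m (+ m ℤ.* + n) (+ n ℤ.- + 0 ℤ.- + 0 ℤ.* + b) (+ n ℤ.- + t ℤ.- + b) (+ a ℤ.- + 0 ℤ.* + b)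
      ≡⟨ cong₂ (λ d a → V m (+ m ℤ.* + n) d (+ n ℤ.- + t ℤ.- + b) a) (d-eq (+ n) (+ b)) (a-eq (+ a) (+ b)) ⟩
    V m (+ m ℤ.* + n) (+ n) (+ n ℤ.- + t ℤ.- + b) (+ a)
      ≡⟨ cong₂ (T m p q) (z-eq (+ m ℤ.* + n) (+ n) (+ t) (+ b)) (k-eq (+ n) (+ t) (+ a) (+ b)) ⟩
    T m p q z k
      -- The required relation is n C(n-1,a) = (n-a) C(n,a), where n - a = s + k for s = t + b.
      ≡⟨ T-product m n s z k (trans (binom-absorb-complement (+ n) (+ a)) (cong (λ u → ι u * q) (s-eq (+ n) (+ t) (+ a) (+ b)))) refl ⟩
    s / n * q * binom (z ℤ.- + 1) k
      ≡⟨ cong (λ z → s / n * q * binom (z ℤ.- + 1) k) (zs-eq (+ m ℤ.* + n) (+ t) (+ b)) ⟩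
    _ ∎
    where
    p = binom (+ n ℤ.- + 1) (+ a)
    q = binom (+ n) (+ a)
    s = + t ℤ.+ + b
    z = + m ℤ.* + n ℤ.- s
    k = + n ℤ.- + t ℤ.- + a ℤ.- + b
    d-eq : ∀ n b → n ℤ.- + 0 ℤ.- + 0 ℤ.* b ≡ n
    d-eq = ℤ-Solver.solve-∀
    a-eq : ∀ a b → a ℤ.- + 0 ℤ.* b ≡ a
    a-eq = ℤ-Solver.solve-∀
    z-eq : ∀ e n t b → e ℤ.- n ℤ.+ (n ℤ.- t ℤ.- b) ≡ e ℤ.- (t ℤ.+ b)
    z-eq = ℤ-Solver.solve-∀
    k-eq : ∀ n t a b → n ℤ.- t ℤ.- b ℤ.- a ≡ n ℤ.- t ℤ.- a ℤ.- b
    k-eq = ℤ-Solver.solve-∀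
    s-eq : ∀ n t a b → n ℤ.- a ≡ t ℤ.+ b ℤ.+ (n ℤ.- t ℤ.- a ℤ.- b)
    s-eq = ℤ-Solver.solve-∀
    zs-eq : ∀ e t b → e ℤ.- (t ℤ.+ b) ≡ e ℤ.- t ℤ.- b
    zs-eq = ℤ-Solver.solve-∀
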